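{- A countable directed forest is unary FA-presentable if and only if (1) it has only finitely many infinite connected components, each of which is a unary FA-presentable directed tree, and (2) there is a bound on the number of vertices of its finite connected components.
   Context: A directed forest is a directed graph obtained from a forest (an acyclic undirected graph) by assigning a direction to each edge; its connected components (components of the underlying undirected graph) are directed trees. A structure $(X,\eta)$ is unary FA-presentable if there exist a regular language $L\subseteq a^*$ and a surjection $\phi:L\to X$ such that $\{(u,v)\in L^2:u\phi=v\phi\}$ and $\{(u,v)\in L^2:(u\phi,v\phi)\in\eta\}$ are regular relations (the words $\mathrm{conv}(u,v)$ over $\{a,\$\}^2$, reading $u,v$ in parallel with the shorter padded by $\$$, form regular languages). -}

module Defs where

open import Data.Bool using (Bool; T)
open import Data.Fin using (Fin; zero; suc; inject₁; fromℕ)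
open import Data.List using (List; []; _∷_; foldl)
open import Data.Maybe using (Maybe; just; nothing)
open import Data.Nat using (ℕ; _+_; _≤_)
open import Data.Product using (Σ; ∃; ∃₂; _×_; _,_; proj₁)
open import Data.Refinement using (Refinement; value)
open import Function.Base using (_on_)
open import Function.Bundles using (_↣_; Inverse)
open import Function.Definitions using (Injective; StrictlySurjective)
open import Level using (0ℓ)
open import Relation.Binary using (Rel; Setoid; Symmetric; Asymmetric; Irreflexive)
open import Relation.Binary.Construct.Closure.Equivalence using (EqClosure)
open import Relation.Binary.Construct.Closure.Symmetric using (SymClosure)
open import Relation.Binary.PropositionalEquality using (_≡_)
open import Relation.Nullary using (¬_)
open import Relation.Unary using (Pred; _≐_)
import Relation.Binary.Construct.Closure.Equivalence as EqClosure
import Relation.Binary.Construct.On as On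
import Relation.Binary.PropositionalEquality as ≡

record DFA (A : Set) : Set where
  field
    size      : ℕ
    start     : Fin size
    step      : Fin size → A → Fin size
    accepting : Fin size → Bool

-- Membership is a `T _`, so it has at most one proof: `∃ (Language M)` is
-- really the set of accepted words.
Language : {A : Set} → DFA A → Pred (List A) 0ℓ
Language M w = T (accepting (foldl step start w))
  where open DFA M

IsRegular : {A : Set} → Pred (List A) 0ℓ → Set
IsRegular {A} P = ∃ λ (M : DFA A) → P ≐ Language M

-- `nothing` is the padding symbol $.
conv : {A : Set} → List A → List A → List (Maybe A × Maybe A)
conv []       []       = []
conv (x ∷ xs) []       = (just x , nothing) ∷ conv xs []
conv []       (y ∷ ys) = (nothing , just y) ∷ conv [] ys
conv (x ∷ xs) (y ∷ ys) = (just x , just y) ∷ conv xs ys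

IsRegularRelation : {A : Set} → Rel (List A) 0ℓ → Set
IsRegularRelation R = IsRegular λ w → ∃₂ λ u v → R u v × w ≡ conv u v

data Unary : Set where
  a : Unary

Pullback : {A X : Set} {L : Pred (List A) 0ℓ} → (∃ L → X) → Rel X 0ℓ → Rel (List A) 0ℓ
Pullback {L = L} φ R u v = Σ (L u) λ p → Σ (L v) λ q → R (φ (u , p)) (φ (v , q))

record UnaryFAPresentable {X : Set} (η : Rel X 0ℓ) : Set where
  field
    automaton        : DFA Unary
    φ                : ∃ (Language automaton) → X
    surjective       : StrictlySurjective _≡_ φ
    equality-regular : IsRegularRelation (Pullback φ _≡_)
    relation-regular : IsRegularRelation (Pullback φ η)

HasCardinality : Setoid 0ℓ 0ℓ → ℕ → Set
HasCardinality S n = Inverse S (≡.setoid (Fin n))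

FiniteSetoid : Setoid 0ℓ 0ℓ → Set
FiniteSetoid S = ∃ (HasCardinality S)

Finite Infinite : Set → Set
Finite X = FiniteSetoid (≡.setoid X)
Infinite X = ¬ Finite X

-- Finite or countably infinite.
Countable : Set → Set
Countable X = X ↣ ℕ

record Cycle {X : Set} (G : Rel X 0ℓ) : Set where
  field
    n        : ℕ
    vertex   : Fin (3 + n) → X
    distinct : Injective _≡_ _≡_ vertex
    edge     : (i : Fin (2 + n)) → G (vertex (inject₁ i)) (vertex (suc i))
    closing  : G (vertex (fromℕ (2 + n))) (vertex zero)

record IsForest {X : Set} (G : Rel X 0ℓ) : Set where
  field
    symmetric   : Symmetric G
    irreflexive : Irreflexive _≡_ G
    acyclic     : ¬ Cycle G

-- `SymClosure E` is the underlying undirected graph; asymmetry says that each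
-- of its edges carries exactly one direction.
record IsDirectedForest {X : Set} (E : Rel X 0ℓ) : Set where
  field
    asymmetric : Asymmetric E
    forest     : IsForest (SymClosure E)

record IsDirectedTree {X : Set} (E : Rel X 0ℓ) : Set where
  field
    directedForest : IsDirectedForest E
    connected      : ∀ x y → EqClosure E x y

-- The vertices of the component of x. Paths are not unique, so the connecting
-- path is kept irrelevant and each vertex occurs only once.
Component : {X : Set} → Rel X 0ℓ → X → Set
Component {X} E x = Refinement X (EqClosure E x)

ComponentEdge : {X : Set} (E : Rel X 0ℓ) (x : X) → Rel (Component E x) 0ℓ
ComponentEdge E x = E on value

-- Components are represented by their vertices, two vertices being identified
-- when they are connected.
InfiniteComponents : {X : Set} → Rel X 0ℓ → Setoid 0ℓ 0ℓ
InfiniteComponents {X} E = On.setoid {B = ∃ λ x → Infinite (Component E x)} (EqClosure.setoid E) proj₁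

FiniteComponentsBounded : {X : Set} → Rel X 0ℓ → Set
FiniteComponentsBounded E = ∃ λ b → ∀ x n → HasCardinality (≡.setoid (Component E x)) n → n ≤ b

{-# OPTIONS --safe #-}

-- A unary word is a natural number, and a relation on ℕ is regular iff for some N
-- it is invariant under adding N to both numbers (when both are ≥ N) and under
-- adding N to the larger one (when they are ≥ N apart).  So a unary FA-presentation
-- amounts to an injection f : X → ℕ for which the images of _≡_ and E are N-periodic
-- in this sense; φ is made injective by keeping least representatives.
--
-- (⇒) Paths inside [N, ∞) may be shifted up by N, so every component is eventually
-- closed under adding some multiple of N, hence ultimately periodic.  A finite
-- component inside [N, ∞) has no two congruent vertices mod N, so it has at most N.
-- An edge of length ≥ N inside [N, ∞) would create a 4-cycle; hence an infinite
-- component meets [0, N) or every window [s, s + N) with s large, and there are at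
-- most 2N of those.
--
-- (⇐) Presentations of disjoint unions of components are interleaved.  The finite
-- components have finitely many isomorphism types; listing the components of each
-- type gives a coding in blocks of constant length that is eventually periodic.
module Submission where

open import Defs
open import Axiom.ExcludedMiddle using (ExcludedMiddle)
open import Data.Bool using (T)
open import Data.Bool.Properties using (T-irrelevant)
open import Data.Empty using (⊥)
open import Data.Fin using (Fin; zero; suc; toℕ; fromℕ<; combine; remQuot; join; splitAt; funToFin; finToFun)
open import Data.Fin.Properties using (pigeonhole; toℕ-fromℕ<; fromℕ<-injective; fromℕ<-cong; injective⇒≤; toℕ-injective; toℕ<n)
open import Data.Fin.Properties using (splitAt-join; combine-injective; remQuot-combine; finToFun-funToFin)
open import Data.Irrelevant using ([_])
open import Data.List using (List; []; _∷_; foldl; length; replicate; mapMaybe)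
open import Data.List.Properties using (length-replicate)
open import Data.Maybe using (Maybe; just; nothing)
open import Data.Nat
open import Data.Nat.Divisibility using (_∣_; divides-refl; ∣⇒≤; m∣m*n; n∣m*n)
open import Data.Nat.DivMod
open import Data.Nat.Induction using (<-rec)
open import Data.Nat.Properties
open import Data.Product using (Σ; ∃; ∃₂; _×_; _,_; proj₁; proj₂; map₂)
open import Data.Refinement using (value; _,_)
open import Data.Sum using (_⊎_; inj₁; inj₂; [_,_]′)
open import Data.Sum.Properties using (inj₁-injective; inj₂-injective)
open import Function.Base using (_∘_; id; flip)
open import Function.Bundles using (_⇔_; mk⇔; Equivalence; Inverse; Injection)
open import Function.Construct.Composition using (_⇔-∘_)
open import Function.Construct.Identity using (⇔-id)
open import Level using (0ℓ)
open import Relation.Binary using (Rel; Setoid; Symmetric; tri<; tri≈; tri>)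
open import Relation.Binary.Construct.Closure.Equivalence using (EqClosure)
open import Relation.Binary.Construct.Closure.ReflexiveTransitive using (Star; ε; _◅_; _◅◅_; reverse; return)
open import Relation.Binary.Construct.Closure.Symmetric using (SymClosure; fwd; bwd)
open import Relation.Binary.PropositionalEquality
open import Relation.Nullary using (¬_; yes; no; contradiction)
open import Relation.Nullary.Decidable using (⌊_⌋; toWitness; fromWitness; recompute)
open import Relation.Unary using (Pred; U; _≐_)
import Data.Fin.Properties as Fin
import Relation.Binary.Construct.Closure.Equivalence as EqClosure
import Relation.Binary.Construct.Closure.ReflexiveTransitive as Star
import Relation.Binary.Construct.Closure.Symmetric as SymClosure

open Equivalence using (to; from)

-- Periodic relations on ℕ

∃⁺ : (ℕ → Set) → Set
∃⁺ Q = ∃ λ N → NonZero N × Q N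

-- Closure under nonzero multiples allows finitely many periods or thresholds to be replaced by a
-- common one.
Stable : (ℕ → Set) → Set
Stable Q = ∀ {M N} → NonZero N → M ∣ N → Q M → Q N

common-multiple : ∀ {Q R : ℕ → Set} → Stable Q → Stable R → ∃⁺ Q → ∃⁺ R → ∃⁺ λ N → Q N × R N
common-multiple stableQ stableR (M , M≢0 , q) (N , N≢0 , r) =
  M * N , MN≢0 , stableQ MN≢0 (m∣m*n N) q , stableR MN≢0 (n∣m*n M) r
  where MN≢0 = m*n≢0 M N {{M≢0}} {{N≢0}}

uniform : ∀ {n} {Q : Fin n → ℕ → Set} → (∀ i → Stable (Q i)) → (∀ i → ∃⁺ (Q i)) →
          ∃⁺ λ N → ∀ i → Q i N
uniform {zero}  stable each = 1 , _ , λ ()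
uniform {suc n} stable each
  with N , N≢0 , q , r ← common-multiple (stable zero) (λ N≢0 M∣N r i → stable (suc i) N≢0 M∣N (r i))
                           (each zero) (uniform (stable ∘ suc) (each ∘ suc))
  = N , N≢0 , λ { zero → q ; (suc i) → r i }

-- A nonzero multiple of `M` is at least `M`, so thresholds merge by the same mechanism as periods.
monotone⇒stable : ∀ {Q : ℕ → Set} → (∀ {m n} → m ≤ n → Q m → Q n) → Stable Q
monotone⇒stable mono N≢0 M∣N = mono (∣⇒≤ {{N≢0}} M∣N)

bounded : ∀ {n} (f : Fin n → ℕ) → ∃ λ b → ∀ i → f i < b
bounded f with b , _ , f<b ← uniform (λ i → monotone⇒stable {f i <_} λ m≤n p → <-≤-trans p m≤n)
                               (λ i → suc (f i) , _ , ≤-refl)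
  = b , f<b

iterate-shift : ∀ (Q : ℕ → Set) {t p} → (∀ {v} → t ≤ v → Q v → Q (v + p)) →
                ∀ k {v} → t ≤ v → Q v → Q (v + k * p)
iterate-shift Q {t} {p} step zero    {v} t≤v q = subst Q (sym (+-identityʳ v)) q
iterate-shift Q {t} {p} step (suc k) {v} t≤v q =
  subst Q (+-assoc v p (k * p)) (iterate-shift Q step k (≤-trans t≤v (m≤m+n v p)) (step t≤v q))

congruent⇒shift : ∀ p .{{_ : NonZero p}} {v w} → v ≤ w → v % p ≡ w % p → ∃ λ k → w ≡ v + k * p
congruent⇒shift p {v} {w} v≤w eq = w / p ∸ v / p , (begin
  w                                            ≡⟨ m≡m%n+[m/n]*n w p ⟩
  w % p + w / p * p                            ≡⟨ cong₂ (λ r q → r + q * p) (sym eq) (sym (m+[n∸m]≡n (/-monoˡ-≤ p v≤w))) ⟩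
  v % p + (v / p + (w / p ∸ v / p)) * p        ≡⟨ cong (v % p +_) (*-distribʳ-+ p (v / p) _) ⟩
  v % p + (v / p * p + (w / p ∸ v / p) * p)    ≡⟨ +-assoc (v % p) _ _ ⟨
  v % p + v / p * p + (w / p ∸ v / p) * p      ≡⟨ cong (_+ (w / p ∸ v / p) * p) (sym (m≡m%n+[m/n]*n v p)) ⟩
  v + (w / p ∸ v / p) * p                      ∎)
  where open ≡-Reasoning

shift-nonZero : ∀ k {v w p} → v < w → w ≡ v + k * p → NonZero k
shift-nonZero zero    {v} v<w eq = contradiction (sym (trans eq (+-identityʳ v))) (<⇒≢ v<w)
shift-nonZero (suc k) v<w eq = _

-- One number serves as threshold and as period; passing to a suitable multiple of a period achieves
-- this.
Periodic : ℕ → Pred ℕ 0ℓ → Set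
Periodic N Q = ∀ {m} → N ≤ m → Q m ⇔ Q (m + N)

data Shift (N m n : ℕ) : ℕ → ℕ → Set where
  both  : N ≤ m → N ≤ n → Shift N m n (m + N) (n + N)
  left  : n + N ≤ m → Shift N m n (m + N) n
  right : m + N ≤ n → Shift N m n m (n + N)

-- By pumping in the two phases of conv, these are the relations on ℕ ≅ a*
-- that a finite automaton recognises.
Periodic₂ : ℕ → Rel ℕ 0ℓ → Set
Periodic₂ N R = ∀ {m n m′ n′} → Shift N m n m′ n′ → R m n ⇔ R m′ n′

Periodic-stable : ∀ {Q} → Stable λ N → Periodic N Q
Periodic-stable {Q} {M} N≢0 (divides-refl k) periodic {m} N≤m =
  iterate-shift (λ v → Q m ⇔ Q v) (λ M≤v eq → periodic M≤v ⇔-∘ eq) k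
    (≤-trans (∣⇒≤ {{N≢0}} (n∣m*n k)) N≤m) (⇔-id (Q m))

Periodic₂-stable : ∀ {R} → Stable λ N → Periodic₂ N R
Periodic₂-stable {R} {M} N≢0 (divides-refl k) periodic {m} {n} = λ where
    -- Both coordinates move, so the induction runs over their common increment `i`, starting from
    -- 0.
    (both N≤m N≤n) → iterate-shift (λ i → R m n ⇔ R (m + i) (n + i)) {0} {M}
      (λ {i} _ eq → subst₂ (λ m′ n′ → R m n ⇔ R m′ n′) (+-assoc m i M) (+-assoc n i M)
        (periodic (both (m≤n⇒m≤n+o i (≤-trans M≤N N≤m)) (m≤n⇒m≤n+o i (≤-trans M≤N N≤n))) ⇔-∘ eq))
      k {0} z≤n (subst₂ (λ m′ n′ → R m n ⇔ R m′ n′) (sym (+-identityʳ m)) (sym (+-identityʳ n)) (⇔-id _))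
    (left far) → iterate-shift (λ v → R m n ⇔ R v n)
      (λ M≤v eq → periodic (left M≤v) ⇔-∘ eq) k (≤-trans (+-monoʳ-≤ n M≤N) far) (⇔-id _)
    (right far) → iterate-shift (λ v → R m n ⇔ R m v)
      (λ M≤v eq → periodic (right M≤v) ⇔-∘ eq) k (≤-trans (+-monoʳ-≤ m M≤N) far) (⇔-id _)
  where
  M≤N : M ≤ k * M
  M≤N = ∣⇒≤ {{N≢0}} (n∣m*n k)

Periodic₂-⇔ : ∀ {N} {R S : Rel ℕ 0ℓ} → (∀ {m n} → R m n ⇔ S m n) → Periodic₂ N R → Periodic₂ N S
Periodic₂-⇔ R⇔S periodic s = mk⇔ (to R⇔S ∘ to (periodic s) ∘ from R⇔S) (to R⇔S ∘ from (periodic s) ∘ from R⇔S)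

Periodic₂-⊎ : ∀ {N} {R S : Rel ℕ 0ℓ} → Periodic₂ N R → Periodic₂ N S → Periodic₂ N (λ m n → R m n ⊎ S m n)
Periodic₂-⊎ r s sh = mk⇔
  (λ { (inj₁ p) → inj₁ (to (r sh) p) ; (inj₂ p) → inj₂ (to (s sh) p) })
  (λ { (inj₁ p) → inj₁ (from (r sh) p) ; (inj₂ p) → inj₂ (from (s sh) p) })

Shift-flip : ∀ {N m n m′ n′} → Shift N m n m′ n′ → Shift N n m n′ m′
Shift-flip (both p q) = both q p
Shift-flip (left p)   = right p
Shift-flip (right p)  = left p

Periodic₂-flip : ∀ {N} {R : Rel ℕ 0ℓ} → Periodic₂ N R → Periodic₂ N (flip R)
Periodic₂-flip r = r ∘ Shift-flip

Periodic₂-restrict : ∀ {N Q R} → Periodic N Q → Periodic₂ N R → Periodic₂ N (λ m n → R m n × Q m × Q n)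
Periodic₂-restrict {N} {Q} {R} q r s = mk⇔
    (λ (x , y , z) → to (r s) x , to (fst s) y , to (snd s) z)
    (λ (x , y , z) → from (r s) x , from (fst s) y , from (snd s) z)
  where
  fst : ∀ {m n m′ n′} → Shift N m n m′ n′ → Q m ⇔ Q m′
  fst (both N≤m _)  = q N≤m
  fst (left far)    = q (m+n≤o⇒n≤o _ far)
  fst (right _)     = ⇔-id _
  snd : ∀ {m n m′ n′} → Shift N m n m′ n′ → Q n ⇔ Q n′
  snd = fst ∘ Shift-flip

-- From automata to injective periodic presentations

module _ {A : Set} (f : A → A) where

  iter : ℕ → A → A
  iter zero    q = q
  iter (suc n) q = iter n (f q)

  iter-+ : ∀ m n q → iter (m + n) q ≡ iter n (iter m q)
  iter-+ zero    n q = refl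
  iter-+ (suc m) n q = iter-+ m n (f q)

IterPeriodic : {A : Set} → (A → A) → A → ℕ → Set
IterPeriodic f q N = ∀ {m} → N ≤ m → iter f m q ≡ iter f (m + N) q

IterPeriodic-stable : ∀ {A : Set} (f : A → A) q → Stable (IterPeriodic f q)
IterPeriodic-stable f q N≢0 (divides-refl k) periodic {m} N≤m =
  iterate-shift (λ v → iter f m q ≡ iter f v q) (λ M≤v eq → trans eq (periodic M≤v)) k
    (≤-trans (∣⇒≤ {{N≢0}} (n∣m*n k)) N≤m) refl

iter-periodic : ∀ {n} (f : Fin n → Fin n) q → ∃⁺ (IterPeriodic f q)
iter-periodic {n} f q
  with i , j , i<j , eq ← pigeonhole (n<1+n n) (λ i → iter f (toℕ i) q)
  -- The iterates repeat with period `p` from time `t` on; `suc t * p` is a multiple of `p` that is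
  -- also at least `t`.
  = suc t * p , m*n≢0 (suc t) p {{_}} {{p≢0}} , λ {m} N≤m →
      iterate-shift (λ v → iter f m q ≡ iter f v q) (λ t≤v → flip trans (step t≤v)) (suc t) (≤-trans t≤N N≤m) refl
  where
  t p : ℕ
  t = toℕ i
  p = toℕ j ∸ t
  p≢0 : NonZero p
  p≢0 = >-nonZero (m<n⇒0<n∸m i<j)
  t≤N : t ≤ suc t * p
  t≤N = ≤-trans (n≤1+n t) (m≤m*n (suc t) p {{p≢0}})
  step : ∀ {v} → t ≤ v → iter f v q ≡ iter f (v + p) q
  step {v} t≤v = begin
    iter f v q                   ≡⟨ cong (λ w → iter f w q) (m+[n∸m]≡n t≤v) ⟨
    iter f (t + (v ∸ t)) q       ≡⟨ iter-+ f t (v ∸ t) q ⟩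
    iter f (v ∸ t) (iter f t q)  ≡⟨ cong (iter f (v ∸ t)) eq ⟩
    iter f (v ∸ t) (iter f (toℕ j) q) ≡⟨ iter-+ f (toℕ j) (v ∸ t) q ⟨
    iter f (toℕ j + (v ∸ t)) q   ≡⟨ cong (λ w → iter f w q) shift ⟩
    iter f (v + p) q             ∎
    where
    open ≡-Reasoning
    shift : toℕ j + (v ∸ t) ≡ v + p
    shift = begin
      toℕ j + (v ∸ t)       ≡⟨ cong (_+ (v ∸ t)) (m+[n∸m]≡n (<⇒≤ i<j)) ⟨
      t + p + (v ∸ t)       ≡⟨ cong (_+ (v ∸ t)) (+-comm t p) ⟩
      p + t + (v ∸ t)       ≡⟨ +-assoc p t (v ∸ t) ⟩
      p + (t + (v ∸ t))     ≡⟨ cong (p +_) (m+[n∸m]≡n t≤v) ⟩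
      p + v                 ≡⟨ +-comm p v ⟩
      v + p                 ∎

iter-uniformly-periodic : ∀ {n} (f : Fin n → Fin n) → ∃⁺ λ N → ∀ q → IterPeriodic f q N
iter-uniformly-periodic f = uniform (IterPeriodic-stable f) (iter-periodic f)

a^_ : ℕ → List Unary
a^ m = replicate m a

a^-length : ∀ u → a^ length u ≡ u
a^-length []      = refl
a^-length (a ∷ u) = cong (a ∷_) (a^-length u)

-- Erasing the padding recovers each track, which makes `conv` injective.
mapMaybe-conv₁ : ∀ {A : Set} (u v : List A) → mapMaybe proj₁ (conv u v) ≡ u
mapMaybe-conv₁ []      []      = refl
mapMaybe-conv₁ (x ∷ u) []      = cong (x ∷_) (mapMaybe-conv₁ u [])
mapMaybe-conv₁ []      (y ∷ v) = mapMaybe-conv₁ [] v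
mapMaybe-conv₁ (x ∷ u) (y ∷ v) = cong (x ∷_) (mapMaybe-conv₁ u v)

mapMaybe-conv₂ : ∀ {A : Set} (u v : List A) → mapMaybe proj₂ (conv u v) ≡ v
mapMaybe-conv₂ []      []      = refl
mapMaybe-conv₂ (x ∷ u) []      = mapMaybe-conv₂ u []
mapMaybe-conv₂ []      (y ∷ v) = cong (y ∷_) (mapMaybe-conv₂ [] v)
mapMaybe-conv₂ (x ∷ u) (y ∷ v) = cong (y ∷_) (mapMaybe-conv₂ u v)

conv-injective : ∀ {A : Set} (u v u′ v′ : List A) → conv u v ≡ conv u′ v′ → u ≡ u′ × v ≡ v′
conv-injective u v u′ v′ eq =
  trans (sym (mapMaybe-conv₁ u v)) (trans (cong (mapMaybe proj₁) eq) (mapMaybe-conv₁ u′ v′)) ,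
  trans (sym (mapMaybe-conv₂ u v)) (trans (cong (mapMaybe proj₂) eq) (mapMaybe-conv₂ u′ v′))

-- On the convolution of two unary words the automaton iterates `g` along the common part and then
-- `l` or `r` along the excess. Each is a self-map of a finite set, so a common eventual period of
-- the three works for the relation.
regular⇒periodic : ∀ {R} → IsRegularRelation R → ∃⁺ λ N → Periodic₂ N (λ m n → R (a^ m) (a^ n))
regular⇒periodic {R} (M , sound , complete) =
    let N , N≢0 , gp , lp , rp = common-multiple (stable g)
          (λ N≢0 M∣N (p , q) → stable l N≢0 M∣N p , stable r N≢0 M∣N q)
          (iter-uniformly-periodic g)
          (common-multiple (stable l) (stable r) (iter-uniformly-periodic l) (iter-uniformly-periodic r))
    in N , N≢0 , λ s → mk⇔
      (λ p → recognised (subst (λ q → T (DFA.accepting M q)) (σ-shift gp lp rp start s) (recognise p)))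
      (λ p → recognised (subst (λ q → T (DFA.accepting M q)) (sym (σ-shift gp lp rp start s)) (recognise p)))
  where
  open DFA M using (size; start; step)
  stable : (f : Fin size → Fin size) → Stable λ N → ∀ q → IterPeriodic f q N
  stable f N≢0 M∣N p q = IterPeriodic-stable f q N≢0 M∣N (p q)
  g l r : Fin size → Fin size
  g q = step q (just a , just a)
  l q = step q (just a , nothing)
  r q = step q (nothing , just a)
  σ : Fin size → ℕ → ℕ → Fin size
  σ q m n = foldl step q (conv (a^ m) (a^ n))
  recognise : ∀ {m n} → R (a^ m) (a^ n) → T (DFA.accepting M (σ start m n))
  recognise p = sound (_ , _ , p , refl)
  recognised : ∀ {m n} → T (DFA.accepting M (σ start m n)) → R (a^ m) (a^ n)
  recognised {m} {n} p with u , v , p′ , eq ← complete p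
                       with refl , refl ← conv-injective (a^ m) (a^ n) u v eq = p′
  σ-left : ∀ q m → σ q m 0 ≡ iter l m q
  σ-left q zero    = refl
  σ-left q (suc m) = σ-left (l q) m
  σ-right : ∀ q n → σ q 0 n ≡ iter r n q
  σ-right q zero    = refl
  σ-right q (suc n) = σ-right (r q) n
  σ-both : ∀ q k m n → σ q (k + m) (k + n) ≡ σ (iter g k q) m n
  σ-both q zero    m n = refl
  σ-both q (suc k) m n = σ-both (g q) k m n
  module _ {N} (gp : ∀ q → IterPeriodic g q N) (lp : ∀ q → IterPeriodic l q N) (rp : ∀ q → IterPeriodic r q N) where
    σ-shift : ∀ q {m n m′ n′} → Shift N m n m′ n′ → σ q m n ≡ σ q m′ n′
    -- After `N` common letters the state already lies on a cycle of `g`, and `N` more letters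
    -- return to it.
    σ-shift q {m} {n} (both N≤m N≤n)
      with m₀ , refl ← m≤n⇒∃[o]m+o≡n N≤m
      with n₀ , refl ← m≤n⇒∃[o]m+o≡n N≤n = begin
      σ q (N + m₀) (N + n₀)             ≡⟨ σ-both q N m₀ n₀ ⟩
      σ (iter g N q) m₀ n₀              ≡⟨ cong (λ q → σ q m₀ n₀) (trans (gp q ≤-refl) (iter-+ g N N q)) ⟩
      σ (iter g N (iter g N q)) m₀ n₀   ≡⟨ σ-both (iter g N q) N m₀ n₀ ⟨
      σ (iter g N q) (N + m₀) (N + n₀)  ≡⟨ σ-both q N (N + m₀) (N + n₀) ⟨
      σ q (N + (N + m₀)) (N + (N + n₀)) ≡⟨ cong₂ (σ q) (+-comm N (N + m₀)) (+-comm N (N + n₀)) ⟩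
      σ q (N + m₀ + N) (N + n₀ + N)     ∎
      where open ≡-Reasoning
    -- Common letters are consumed until the shorter word is empty; the excess, still at least `N`
    -- long, is then pumped.
    σ-shift q {m} {zero} (left far) = trans (σ-left q m) (trans (lp q far) (sym (σ-left q (m + N))))
    σ-shift q {suc m} {suc n} (left far) = σ-shift (g q) (left (s≤s⁻¹ far))
    σ-shift q {zero} {n} (right far) = trans (σ-right q n) (trans (rp q far) (sym (σ-right q (n + N))))
    σ-shift q {suc m} {suc n} (right far) = σ-shift (g q) (right (s≤s⁻¹ far))

-- Injective codes from least representatives

Image : {X : Set} → Pred X 0ℓ → (X → ℕ) → Rel X 0ℓ → Rel ℕ 0ℓ
Image P f R m n = ∃₂ λ x y → (P x × P y) × (f x ≡ m × f y ≡ n) × R x y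

-- The predicate `P` singles out the vertices being coded, so that parts of `X` can be presented
-- separately and then united inside `X`. Since the image of equality is diagonal, `≡-periodic` says
-- that the set of codes is ultimately periodic.
record Presentation {X : Set} (P : Pred X 0ℓ) (E : Rel X 0ℓ) : Set where
  field
    N          : ℕ
    N≢0        : NonZero N
    f          : X → ℕ
    injective  : ∀ {x y} → P x → P y → f x ≡ f y → x ≡ y
    ≡-periodic : Periodic₂ N (Image P f _≡_)
    E-periodic : Periodic₂ N (Image P f E)

least : ExcludedMiddle 0ℓ → ∀ (Q : ℕ → Set) → ∃ Q → ∃ λ m → Q m × (∀ {k} → k < m → ¬ Q k)
least em Q (n , q) = <-rec (λ n → Q n → ∃ λ m → Q m × (∀ {k} → k < m → ¬ Q k)) search n q
  where
  search : ∀ n → (∀ {m} → m < n → Q m → ∃ λ m → Q m × (∀ {k} → k < m → ¬ Q k)) →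
           Q n → ∃ λ m → Q m × (∀ {k} → k < m → ¬ Q k)
  search n rec q with em {∃ λ m → m < n × Q m}
  ... | yes (m , m<n , q′) = rec m<n q′
  ... | no none = n , q , λ k<n q′ → none (_ , k<n , q′)

module LeastRepresentatives (em : ExcludedMiddle 0ℓ) {X : Set} {E : Rel X 0ℓ} (pres : UnaryFAPresentable E) where

  open UnaryFAPresentable pres

  Word : Rel X 0ℓ → Rel ℕ 0ℓ
  Word R m n = Pullback φ R (a^ m) (a^ n)

  Represents : ℕ → X → Set
  Represents m x = Σ (Language automaton (a^ m)) λ p → φ (a^ m , p) ≡ x

  representation : ∀ x → ∃ λ m → Represents m x
  representation x with (w , p) , eq ← surjective x = length w , rep (sym (a^-length w)) p eq
    where
    rep : ∀ {w v} → w ≡ v → (p : Language automaton w) → φ (w , p) ≡ x →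
          Σ (Language automaton v) λ q → φ (v , q) ≡ x
    rep refl p eq = p , eq

  code : X → ℕ
  code x = proj₁ (least em (λ m → Represents m x) (representation x))

  code-represents : ∀ x → Represents (code x) x
  code-represents x = proj₁ (proj₂ (least em (λ m → Represents m x) (representation x)))

  code-least : ∀ x {k} → k < code x → ¬ Represents k x
  code-least x = proj₂ (proj₂ (least em (λ m → Represents m x) (representation x)))

  represents-unique : ∀ {m x y} → Represents m x → Represents m y → x ≡ y
  represents-unique {m} (p , eq) (q , eq′) =
    trans (sym eq) (trans (cong (λ p → φ (a^ m , p)) (T-irrelevant p q)) eq′)

  code-injective : ∀ {x y} → code x ≡ code y → x ≡ y
  code-injective {x} {y} eq =
    represents-unique (code-represents x) (subst (λ m → Represents m y) (sym eq) (code-represents y))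

  -- Phrased through `Word _≡_` alone, so that periodicity can be derived from regularity of
  -- equality.
  Least : Pred ℕ 0ℓ
  Least m = Word _≡_ m m × (∀ {k} → k < m → ¬ Word _≡_ k m)

  code-Least : ∀ x → Least (code x)
  code-Least x with p , eq ← code-represents x =
    (p , p , refl) , λ k<m (q , p′ , eq′) →
      code-least x k<m (q , trans eq′ (represents-unique (p′ , refl) (p , eq)))

  Least-code : ∀ {m x} → Least m → Represents m x → code x ≡ m
  Least-code {m} {x} (_ , minimal) (p , eq) with <-cmp (code x) m
  ... | tri< lt _ _ = contradiction
    (proj₁ (code-represents x) , p , trans (proj₂ (code-represents x)) (sym eq)) (minimal lt)
  ... | tri≈ _ eq′ _ = eq′
  ... | tri> _ _ gt = contradiction (p , eq) (code-least x gt)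

  Image⇔Word : ∀ {R : Rel X 0ℓ} {m n} → (Word R m n × Least m × Least n) ⇔ Image U code R m n
  Image⇔Word {R} = mk⇔
    (λ ((p , q , r) , lm , ln) → _ , _ , _ , (Least-code lm (p , refl) , Least-code ln (q , refl)) , r)
    (λ { (x , y , _ , (refl , refl) , r) → word x y r , code-Least x , code-Least y })
    where
    word : ∀ x y → R x y → Word R (code x) (code y)
    word x y r with p , eq ← code-represents x | q , eq′ ← code-represents y =
      p , q , subst₂ R (sym eq) (sym eq′) r

  module _ {N} (N≢0 : NonZero N) (≡-per : Periodic₂ N (Word _≡_)) where

    -- A competitor `k` of `m + N` with `k ≥ 2N` is moved down by `N` along with it. If `k ≤ 2N`,
    -- then `3N ≤ m` puts `k` at distance at least `N` below `m`, and only the larger number is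
    -- moved.
    Least-step : ∀ {m} → 3 * N ≤ m → Least m ⇔ Least (m + N)
    Least-step {m} 3N≤m = mk⇔
        (λ (p , minimal) → to (≡-per (both N≤m N≤m)) p , up minimal)
        (λ (p , minimal) → from (≡-per (both N≤m N≤m)) p , down minimal)
      where
      2N≤m : N + N ≤ m
      2N≤m = ≤-trans (+-monoʳ-≤ N (m≤m+n N (N + 0))) 3N≤m
      N≤m : N ≤ m
      N≤m = ≤-trans (m≤m+n N N) 2N≤m
      up : (∀ {k} → k < m → ¬ Word _≡_ k m) → ∀ {k} → k < m + N → ¬ Word _≡_ k (m + N)
      up minimal {k} k<m+N p with ≤-total (N + N) k
      ... | inj₁ 2N≤k with k′ , refl ← m≤n⇒∃[o]m+o≡n 2N≤k =
        minimal {N + k′} (+-cancelʳ-< N (N + k′) m (subst (_< m + N) eq k<m+N))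
          (from (≡-per (both (m≤m+n N k′) N≤m)) (subst (λ k → Word _≡_ k (m + N)) eq p))
        where
        eq : N + N + k′ ≡ N + k′ + N
        eq = trans (+-assoc N N k′) (+-comm N (N + k′))
      ... | inj₂ k≤2N = minimal (<-≤-trans (m<m+n k (>-nonZero⁻¹ N {{N≢0}})) k+N≤m) (from (≡-per (right k+N≤m)) p)
        where
        k+N≤m : k + N ≤ m
        k+N≤m = ≤-trans (+-monoˡ-≤ N k≤2N) (≤-trans (≤-reflexive 2N+N≡3N) 3N≤m)
          where
          2N+N≡3N : N + N + N ≡ 3 * N
          2N+N≡3N = trans (+-assoc N N N) (cong (λ x → N + (N + x)) (sym (+-identityʳ N)))
      down : (∀ {k} → k < m + N → ¬ Word _≡_ k (m + N)) → ∀ {k} → k < m → ¬ Word _≡_ k m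
      down minimal {k} k<m p with ≤-total N k
      ... | inj₁ N≤k = minimal (+-monoˡ-< N k<m) (to (≡-per (both N≤k N≤m)) p)
      ... | inj₂ k≤N = minimal (m≤n⇒m≤n+o N k<m) (to (≡-per (right (≤-trans (+-monoˡ-≤ N k≤N) 2N≤m))) p)

    Least-periodic : Periodic (3 * N) Least
    Least-periodic {m} 3N≤m = iterate-shift (λ v → Least m ⇔ Least v)
      (λ 3N≤v eq → Least-step 3N≤v ⇔-∘ eq) 3 3N≤m (⇔-id _)

    3N≢0 : NonZero (3 * N)
    3N≢0 = m*n≢0 3 N {{_}} {{N≢0}}

    Image-periodic : ∀ {R : Rel X 0ℓ} → Periodic₂ N (Word R) → Periodic₂ (3 * N) (Image U code R)
    Image-periodic periodic = Periodic₂-⇔ Image⇔Word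
      (Periodic₂-restrict Least-periodic (Periodic₂-stable 3N≢0 (n∣m*n 3) periodic))

  presentation : Presentation U E
  presentation = from-period (common-multiple Periodic₂-stable Periodic₂-stable
    (regular⇒periodic equality-regular) (regular⇒periodic relation-regular))
    where
    from-period : ∃⁺ (λ N → Periodic₂ N (Word _≡_) × Periodic₂ N (Word E)) → Presentation U E
    from-period (N , N≢0 , ≡-per , E-per) = record
      { N = 3 * N ; N≢0 = 3N≢0 N≢0 ≡-per ; f = code ; injective = λ _ _ → code-injective
      ; ≡-periodic = Image-periodic N≢0 ≡-per ≡-per ; E-periodic = Image-periodic N≢0 ≡-per E-per }

-- From periodic presentations to automata

-- A machine with infinitely many states recognises a regular language as soon
-- as its states can be coloured compatibly with finitely many colours.
module Colouring (em : ExcludedMiddle 0ℓ) {A S : Set} (δ : S → A → S) {c : ℕ} (κ : S → Fin c)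
                 (κ-cong : ∀ {s t} x → κ s ≡ κ t → κ (δ s x) ≡ κ (δ t x)) where

  step : Fin c → A → Fin c
  step k x with em {∃ λ s → κ s ≡ k}
  ... | yes (s , _) = κ (δ s x)
  -- A default: runs only pass through colours of actual states.
  ... | no  _       = k

  step-κ : ∀ s x → step (κ s) x ≡ κ (δ s x)
  step-κ s x with em {∃ λ t → κ t ≡ κ s}
  ... | yes (t , eq) = κ-cong x eq
  ... | no  none     = contradiction (s , refl) none

  run-κ : ∀ s w → foldl step (κ s) w ≡ κ (foldl δ s w)
  run-κ s []      = refl
  run-κ s (x ∷ w) = trans (cong (λ k → foldl step k w) (step-κ s x)) (run-κ (δ s x) w)

  regular : (s₀ : S) (Q : Pred S 0ℓ) → (∀ {s t} → κ s ≡ κ t → Q s → Q t) →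
            IsRegular (λ w → Q (foldl δ s₀ w))
  regular s₀ Q Q-resp = M ,
      (λ {w} q → fromWitness {a? = em} (foldl δ s₀ w , sym (run-κ s₀ w) , q)) ,
      (λ {w} p → let s , eq , q = toWitness {a? = em} p in Q-resp (trans eq (run-κ s₀ w)) q)
    where
    M : DFA A
    M = record
      { size      = c
      ; start     = κ s₀
      ; step      = step
      ; accepting = λ k → ⌊ em {∃ λ s → κ s ≡ k × Q s} ⌋
      }

IsRegular-≐ : ∀ {A : Set} {P Q : Pred (List A) 0ℓ} → P ≐ Q → IsRegular P → IsRegular Q
IsRegular-≐ (P⊆Q , Q⊆P) (M , P⊆M , M⊆P) = M , P⊆M ∘ Q⊆P , P⊆Q ∘ M⊆P

module Cap (N : ℕ) .{{_ : NonZero N}} where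

  abstract
    -- The finite information on which an `N`-periodic predicate depends: the truncation at `N`
    -- together with the residue modulo `N`.
    cap : ℕ → Fin (suc N * N)
    cap m = combine (fromℕ< (s≤s (m⊓n≤n m N))) (fromℕ< (m%n<n m N))

    cap⁺ : ∀ {m n} → m ⊓ N ≡ n ⊓ N → m % N ≡ n % N → cap m ≡ cap n
    cap⁺ {m} {n} eq eq′ = cong₂ combine (fromℕ<-cong _ _ eq _ _) (fromℕ<-cong _ _ eq′ _ _)

    cap-⊓ : ∀ {m n} → cap m ≡ cap n → m ⊓ N ≡ n ⊓ N
    cap-⊓ {m} {n} eq = fromℕ<-injective _ _ _ _
      (proj₁ (combine-injective (fromℕ< (s≤s (m⊓n≤n m N))) (fromℕ< (m%n<n m N)) _ _ eq))

    cap-% : ∀ {m n} → cap m ≡ cap n → m % N ≡ n % N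
    cap-% {m} {n} eq = fromℕ<-injective _ _ _ _
      (proj₂ (combine-injective (fromℕ< (s≤s (m⊓n≤n m N))) (fromℕ< (m%n<n m N))
                                (fromℕ< (s≤s (m⊓n≤n n N))) (fromℕ< (m%n<n n N)) eq))

  cap-suc : ∀ {m n} → cap m ≡ cap n → cap (suc m) ≡ cap (suc n)
  cap-suc {m} {n} eq = cap⁺
      (trans (suc-⊓ m) (trans (cong (λ x → suc x ⊓ N) (cap-⊓ eq)) (sym (suc-⊓ n))))
      (trans (suc-% m) (trans (cong (λ x → (1 % N + x) % N) (cap-% eq)) (sym (suc-% n))))
    where
    suc-⊓ : ∀ m → suc m ⊓ N ≡ suc (m ⊓ N) ⊓ N
    suc-⊓ m = begin
      suc m ⊓ N              ≡⟨ cong (suc m ⊓_) (m≥n⇒m⊓n≡n (n≤1+n N)) ⟨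
      suc m ⊓ (suc N ⊓ N)    ≡⟨ ⊓-assoc (suc m) (suc N) N ⟨
      suc (m ⊓ N) ⊓ N        ∎
      where open ≡-Reasoning
    suc-% : ∀ m → suc m % N ≡ (1 % N + m % N) % N
    suc-% m = %-distribˡ-+ 1 m N

  cap-shift : ∀ {m n} → m ≤ n → cap m ≡ cap n → m ≡ n ⊎ (N ≤ m × ∃ λ k → n ≡ m + k * N)
  cap-shift {m} {n} m≤n eq with ≤-total N m
  ... | inj₁ N≤m = inj₂ (N≤m , congruent⇒shift N m≤n (cap-% eq))
  ... | inj₂ m≤N with ≤-total N n
  ...   | inj₂ n≤N = inj₁ (trans (sym (m≤n⇒m⊓n≡m m≤N)) (trans (cap-⊓ eq) (m≤n⇒m⊓n≡m n≤N)))
  -- Here `m ≤ N ≤ n`, so equal truncations force `m` to be `N` itself.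
  ...   | inj₁ N≤n = inj₂ (≤-reflexive N≡m , congruent⇒shift N m≤n (cap-% eq))
    where
    N≡m : N ≡ m
    N≡m = trans (sym (m≥n⇒m⊓n≡n N≤n)) (trans (sym (cap-⊓ eq)) (m≤n⇒m⊓n≡m m≤N))

  cap-resp : ∀ {Q} → Periodic N Q → ∀ {m n} → cap m ≡ cap n → Q m → Q n
  cap-resp {Q} periodic {m} {n} eq with ≤-total m n
  ... | inj₁ m≤n = forward m≤n eq
    where
    forward : ∀ {m n} → m ≤ n → cap m ≡ cap n → Q m → Q n
    forward m≤n eq q with cap-shift m≤n eq
    ... | inj₁ refl = q
    ... | inj₂ (N≤m , k , refl) = iterate-shift Q (λ N≤v → to (periodic N≤v)) k N≤m q
  ... | inj₂ n≤m = backward n≤m (sym eq)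
    where
    backward : ∀ {m n} → m ≤ n → cap m ≡ cap n → Q n → Q m
    backward {m} m≤n eq q with cap-shift m≤n eq
    ... | inj₁ refl = q
    ... | inj₂ (N≤m , k , refl) =
      iterate-shift (λ v → Q v → Q m) (λ N≤v g → g ∘ from (periodic N≤v)) k N≤m id q

module _ (em : ExcludedMiddle 0ℓ) where

  periodic⇒regular : ∀ {N} → NonZero N → {Q : Pred ℕ 0ℓ} → Periodic N Q →
                     IsRegular {Unary} (λ w → Q (length w))
  periodic⇒regular {N} N≢0 {Q} periodic =
      IsRegular-≐ ((λ {w} → subst Q (run 0 w)) , (λ {w} → subst Q (sym (run 0 w))))
        (Colouring.regular em (λ m _ → suc m) cap (λ _ → cap-suc) 0 Q (cap-resp periodic))
    where
    open Cap N {{N≢0}}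
    run : ∀ m (w : List Unary) → foldl (λ m _ → suc m) m w ≡ m + length w
    run m []      = sym (+-identityʳ m)
    run m (x ∷ w) = trans (run (suc m) w) (sym (+-suc m (length w)))

  module PairMachine {N} (N≢0 : NonZero N) {R : Rel ℕ 0ℓ} (periodic : Periodic₂ N R) where

    open Cap N {{N≢0}}

    pattern same    = zero
    pattern longer₁ = suc zero
    pattern longer₂ = suc (suc zero)
    pattern dead    = suc (suc (suc zero))

    -- (phase , i , d): the two words read so far have lengths i and i, i + d
    -- and i, or i and i + d, according to the phase.
    State : Set
    State = Fin 4 × ℕ × ℕ

    δ : State → Maybe Unary × Maybe Unary → State
    δ (same    , i , d) (just a  , just a)  = same , suc i , 0
    δ (same    , i , d) (just a  , nothing) = longer₁ , i , 1
    δ (same    , i , d) (nothing , just a)  = longer₂ , i , 1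
    δ (longer₁ , i , d) (just a  , nothing) = longer₁ , i , suc d
    δ (longer₂ , i , d) (nothing , just a)  = longer₂ , i , suc d
    -- Such input continues no convolution: it pads both tracks at once, or resumes a track that was
    -- already padded, or comes after an earlier failure.
    δ _                 _                   = dead , 0 , 0

    κ : State → Fin (4 * (suc N * N * (suc N * N)))
    κ (phase , i , d) = combine phase (combine (cap i) (cap d))

    κ⁻¹ : ∀ {p i d p′ i′ d′} → κ (p , i , d) ≡ κ (p′ , i′ , d′) → p ≡ p′ × cap i ≡ cap i′ × cap d ≡ cap d′
    κ⁻¹ {p} {p′ = p′} eq with refl , eq′ ← combine-injective p _ p′ _ eq =
      refl , combine-injective _ _ _ _ eq′

    κ≡ : ∀ p {i d i′ d′} → cap i ≡ cap i′ → cap d ≡ cap d′ → κ (p , i , d) ≡ κ (p , i′ , d′)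
    κ≡ p eq eq′ = cong₂ (λ x y → combine p (combine x y)) eq eq′

    κ-cong : ∀ {s t} x → κ s ≡ κ t → κ (δ s x) ≡ κ (δ t x)
    κ-cong {p , i , d} {p′ , i′ , d′} x eq with κ⁻¹ {p} {i} {d} {p′} {i′} {d′} eq
    κ-cong {same , i , d} {_ , i′ , d′} (just a , just a) _   | refl , eqi , eqd = κ≡ same (cap-suc eqi) refl
    κ-cong {same , i , d} {_ , i′ , d′} (just a , nothing) _  | refl , eqi , eqd = κ≡ longer₁ eqi refl
    κ-cong {same , i , d} {_ , i′ , d′} (nothing , just a) _  | refl , eqi , eqd = κ≡ longer₂ eqi refl
    κ-cong {same , i , d} {_ , i′ , d′} (nothing , nothing) _ | refl , eqi , eqd = refl
    κ-cong {longer₁ , i , d} {_ , i′ , d′} (just a , just a) _   | refl , eqi , eqd = refl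
    κ-cong {longer₁ , i , d} {_ , i′ , d′} (just a , nothing) _  | refl , eqi , eqd = κ≡ longer₁ eqi (cap-suc eqd)
    κ-cong {longer₁ , i , d} {_ , i′ , d′} (nothing , _) _       | refl , eqi , eqd = refl
    κ-cong {longer₂ , i , d} {_ , i′ , d′} (just a , _) _        | refl , eqi , eqd = refl
    κ-cong {longer₂ , i , d} {_ , i′ , d′} (nothing , just a) _  | refl , eqi , eqd = κ≡ longer₂ eqi (cap-suc eqd)
    κ-cong {longer₂ , i , d} {_ , i′ , d′} (nothing , nothing) _ | refl , eqi , eqd = refl
    κ-cong {dead , i , d} {_ , i′ , d′} x _ | refl , eqi , eqd = refl

    Accept : Pred State 0ℓ
    Accept (same    , i , d) = R i i
    Accept (longer₁ , i , d) = R (i + d) i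
    Accept (longer₂ , i , d) = R i (i + d)
    Accept (dead    , i , d) = ⊥

    swap-+ : ∀ i d N → i + d + N ≡ i + N + d
    swap-+ i d N = trans (+-assoc i d N) (trans (cong (i +_) (+-comm d N)) (sym (+-assoc i N d)))

    -- In the two longer phases `i` is replaced first and `d` second: changing `i` moves both
    -- numbers, changing `d` only the larger one, and these are exactly the shifts that `R`
    -- respects.
    Accept-resp : ∀ {s t} → κ s ≡ κ t → Accept s → Accept t
    Accept-resp {p , i , d} {p′ , i′ , d′} eq q with κ⁻¹ {p} {i} {d} {p′} {i′} {d′} eq
    Accept-resp {same , i , d} {_ , i′ , d′} _ q | refl , eqi , eqd =
      cap-resp {λ i → R i i} (λ N≤i → periodic (both N≤i N≤i)) eqi q
    Accept-resp {longer₁ , i , d} {_ , i′ , d′} _ q | refl , eqi , eqd =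
      cap-resp {λ d → R (i′ + d) i′}
        (λ {d} N≤d → subst (λ n → R (i′ + d) i′ ⇔ R n i′) (+-assoc i′ d N) (periodic (left (+-monoʳ-≤ i′ N≤d)))) eqd
        (cap-resp {λ i → R (i + d) i}
          (λ {i} N≤i → subst (λ n → R (i + d) i ⇔ R n (i + N)) (swap-+ i d N) (periodic (both (m≤n⇒m≤n+o d N≤i) N≤i))) eqi q)
    Accept-resp {longer₂ , i , d} {_ , i′ , d′} _ q | refl , eqi , eqd =
      cap-resp {λ d → R i′ (i′ + d)}
        (λ {d} N≤d → subst (λ n → R i′ (i′ + d) ⇔ R i′ n) (+-assoc i′ d N) (periodic (right (+-monoʳ-≤ i′ N≤d)))) eqd
        (cap-resp {λ i → R i (i + d)}
          (λ {i} N≤i → subst (λ n → R i (i + d) ⇔ R (i + N) n) (swap-+ i d N) (periodic (both N≤i (m≤n⇒m≤n+o d N≤i)))) eqi q)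
    Accept-resp {dead , i , d} _ () | refl , _

    ¬Accept-dead : ∀ {i d} w → ¬ Accept (foldl δ (dead , i , d) w)
    ¬Accept-dead (x ∷ w) p = ¬Accept-dead w p

    sound₁ : ∀ i d w → Accept (foldl δ (longer₁ , i , d) w) →
             ∃ λ u → R (i + (d + length u)) i × w ≡ conv u []
    sound₁ i d [] q = [] , subst (λ d → R (i + d) i) (sym (+-identityʳ d)) q , refl
    sound₁ i d ((just a , nothing) ∷ w) q with u , r , refl ← sound₁ i (suc d) w q =
      a ∷ u , subst (λ d → R (i + d) i) (sym (+-suc d (length u))) r , refl
    sound₁ i d ((just a , just a) ∷ w) q = contradiction q (¬Accept-dead w)
    sound₁ i d ((nothing , _) ∷ w) q = contradiction q (¬Accept-dead w)

    sound₂ : ∀ i d w → Accept (foldl δ (longer₂ , i , d) w) →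
             ∃ λ v → R i (i + (d + length v)) × w ≡ conv [] v
    sound₂ i d [] q = [] , subst (λ d → R i (i + d)) (sym (+-identityʳ d)) q , refl
    sound₂ i d ((nothing , just a) ∷ w) q with v , r , refl ← sound₂ i (suc d) w q =
      a ∷ v , subst (λ d → R i (i + d)) (sym (+-suc d (length v))) r , refl
    sound₂ i d ((nothing , nothing) ∷ w) q = contradiction q (¬Accept-dead w)
    sound₂ i d ((just a , _) ∷ w) q = contradiction q (¬Accept-dead w)

    sound : ∀ i d w → Accept (foldl δ (same , i , d) w) →
            ∃₂ λ u v → R (i + length u) (i + length v) × w ≡ conv u v
    sound i d [] q = [] , [] , subst₂ R (sym (+-identityʳ i)) (sym (+-identityʳ i)) q , refl
    sound i d ((just a , just a) ∷ w) q with u , v , r , refl ← sound (suc i) 0 w q =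
      a ∷ u , a ∷ v , subst₂ R (sym (+-suc i (length u))) (sym (+-suc i (length v))) r , refl
    sound i d ((just a , nothing) ∷ w) q with u , r , refl ← sound₁ i 1 w q =
      a ∷ u , [] , subst (R _) (sym (+-identityʳ i)) r , refl
    sound i d ((nothing , just a) ∷ w) q with v , r , refl ← sound₂ i 1 w q =
      [] , a ∷ v , subst (λ i′ → R i′ (i + suc (length v))) (sym (+-identityʳ i)) r , refl
    sound i d ((nothing , nothing) ∷ w) q = contradiction q (¬Accept-dead w)

    run₁ : ∀ i d u → foldl δ (longer₁ , i , d) (conv u []) ≡ (longer₁ , i , d + length u)
    run₁ i d []      = cong (λ d → longer₁ , i , d) (sym (+-identityʳ d))
    run₁ i d (a ∷ u) = trans (run₁ i (suc d) u) (cong (λ d → longer₁ , i , d) (sym (+-suc d (length u))))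

    run₂ : ∀ i d v → foldl δ (longer₂ , i , d) (conv [] v) ≡ (longer₂ , i , d + length v)
    run₂ i d []      = cong (λ d → longer₂ , i , d) (sym (+-identityʳ d))
    run₂ i d (a ∷ v) = trans (run₂ i (suc d) v) (cong (λ d → longer₂ , i , d) (sym (+-suc d (length v))))

    complete : ∀ i d u v → R (i + length u) (i + length v) → Accept (foldl δ (same , i , d) (conv u v))
    complete i d [] [] r = subst₂ R (+-identityʳ i) (+-identityʳ i) r
    complete i d (a ∷ u) [] r = subst Accept (sym (run₁ i 1 u)) (subst (R _) (+-identityʳ i) r)
    complete i d [] (a ∷ v) r = subst Accept (sym (run₂ i 1 v)) (subst (λ i′ → R i′ (i + suc (length v))) (+-identityʳ i) r)
    complete i d (a ∷ u) (a ∷ v) r =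
      complete (suc i) 0 u v (subst₂ R (+-suc i (length u)) (+-suc i (length v)) r)

    periodic⇒regularRelation : IsRegularRelation {Unary} (λ u v → R (length u) (length v))
    periodic⇒regularRelation = IsRegular-≐
      ((λ {w} → sound 0 0 w) , λ { (u , v , r , refl) → complete 0 0 u v r })
      (Colouring.regular em δ κ (λ {s} {t} → κ-cong {s} {t}) (same , 0 , 0) Accept (λ {s} {t} → Accept-resp {s} {t}))

  -- A word is accepted when its length is a code, and `φ` decodes it; injectivity of `f` identifies
  -- the pullbacks along `φ` with the images under `f`.
  presentation⇒UnaryFAPresentable : ∀ {X : Set} {E : Rel X 0ℓ} → Presentation U E → UnaryFAPresentable E
  presentation⇒UnaryFAPresentable {X} {E} pres =
      present (periodic⇒regular N≢0 {λ m → Image U f _≡_ m m} (λ N≤m → ≡-periodic (both N≤m N≤m)))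
    where
    open Presentation pres
    present : IsRegular {Unary} (λ w → Image U f _≡_ (length w) (length w)) → UnaryFAPresentable E
    present (M , ⊆M , M⊆) = record
        { automaton        = M
        ; φ                = φ
        ; surjective       = surjective
        ; equality-regular = pull ≡-periodic
        ; relation-regular = pull E-periodic
        }
      where
      φ : ∃ (Language M) → X
      φ (w , p) = proj₁ (M⊆ {w} p)
      f-φ : ∀ w p → f (φ (w , p)) ≡ length w
      f-φ w p with _ , _ , _ , (eq , _) , _ ← M⊆ {w} p = eq
      accept : ∀ x w → length w ≡ f x → Language M w
      accept x w eq = ⊆M {w} (x , x , _ , (sym eq , sym eq) , refl)
      φ-unique : ∀ {x} w p → f x ≡ length w → φ (w , p) ≡ x
      φ-unique w p eq = injective _ _ (trans (f-φ w p) (sym eq))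
      surjective : ∀ x → ∃ λ w → φ w ≡ x
      surjective x = (a^ f x , accept x (a^ f x) (length-replicate (f x))) ,
        φ-unique (a^ f x) _ (sym (length-replicate (f x)))
      pull : ∀ {R : Rel X 0ℓ} → Periodic₂ N (Image U f R) → IsRegularRelation (Pullback φ R)
      pull {R} periodic = IsRegular-≐
        ((λ { (u , v , (x , y , _ , (eqx , eqy) , r) , eq) → u , v ,
               (accept x u (sym eqx) , accept y v (sym eqy) ,
                subst₂ R (sym (φ-unique u _ eqx)) (sym (φ-unique v _ eqy)) r) , eq }) ,
         (λ { (u , v , (p , q , r) , eq) → u , v , (_ , _ , _ , (f-φ u p , f-φ v q) , r) , eq }))
        (PairMachine.periodic⇒regularRelation N≢0 periodic)

-- Connectivity in periodic graphs

module _ (em : ExcludedMiddle 0ℓ) where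

  -- Within a residue class modulo `p`, one member of `Q` beyond `t` brings in all later ones, so
  -- each class is eventually all inside or all outside. A threshold common to the classes, times
  -- `p`, is a period.
  upward-closed⇒periodic : ∀ {Q : Pred ℕ 0ℓ} {t p} → NonZero p → (∀ {v} → t ≤ v → Q v → Q (v + p)) →
                           ∃⁺ λ N → Periodic N Q
  upward-closed⇒periodic {Q} {t} {p} p≢0 step = period (uniform settled-stable settled)
    where
    instance
      _ : NonZero p
      _ = p≢0
    Settled : Fin p → ℕ → Set
    Settled r N = (∀ {v} → N ≤ v → v % p ≡ toℕ r → Q v) ⊎ (∀ {v} → N ≤ v → v % p ≡ toℕ r → ¬ Q v)
    settled-stable : ∀ r → Stable (Settled r)
    settled-stable r = monotone⇒stable λ where
      M≤N (inj₁ always) → inj₁ (always ∘ ≤-trans M≤N)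
      M≤N (inj₂ never)  → inj₂ (never ∘ ≤-trans M≤N)
    settled : ∀ r → ∃⁺ (Settled r)
    settled r with em {∃ λ v → t ≤ v × v % p ≡ toℕ r × Q v}
    ... | no none = suc t , _ , inj₂ λ t<v eq q → none (_ , <⇒≤ t<v , eq , q)
    ... | yes (v₀ , t≤v₀ , eq₀ , q) = suc v₀ , _ , inj₁ λ v₀<v eq →
      let k , v≡ = congruent⇒shift p (<⇒≤ v₀<v) (trans eq₀ (sym eq))
      in subst Q (sym v≡) (iterate-shift Q step k t≤v₀ q)
    period : (∃⁺ λ N → ∀ r → Settled r N) → ∃⁺ λ N → Periodic N Q
    period (N , N≢0 , settle) = N * p , m*n≢0 N p {{N≢0}} , λ {m} Np≤m → eventually Np≤m (settle (m mod p))
      where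
      eventually : ∀ {m} → N * p ≤ m → Settled (m mod p) N → Q m ⇔ Q (m + N * p)
      eventually {m} Np≤m =
          [ (λ always → mk⇔ (λ _ → always N≤m′ eq′) (λ _ → always N≤m eq))
          , (λ never → mk⇔ (flip contradiction (never N≤m eq)) (flip contradiction (never N≤m′ eq′)))
          ]′
        where
        N≤m : N ≤ m
        N≤m = ≤-trans (m≤m*n N p) Np≤m
        N≤m′ : N ≤ m + N * p
        N≤m′ = m≤n⇒m≤n+o (N * p) N≤m
        eq : m % p ≡ toℕ (m mod p)
        eq = sym (toℕ-fromℕ< (m%n<n m p))
        eq′ : (m + N * p) % p ≡ toℕ (m mod p)
        eq′ = trans ([m+kn]%n≡m%n m N p) eq

  module Connectivity {S : Rel ℕ 0ℓ} (S-sym : Symmetric S) {N} (N≢0 : NonZero N) (periodic : Periodic₂ N S) where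

    private instance
      _ : NonZero N
      _ = N≢0

    -- The edges inside `[N, ∞)`: translating such an edge by `N` gives an edge again.
    High : Rel ℕ 0ℓ
    High m n = (N ≤ m × N ≤ n) × S m n

    High-sym : Symmetric High
    High-sym ((N≤m , N≤n) , s) = (N≤n , N≤m) , S-sym s

    High⇒S : ∀ {m n} → Star High m n → Star S m n
    High⇒S = Star.map proj₂

    High-shift : ∀ k {m n} → Star High m n → Star High (m + k * N) (n + k * N)
    High-shift zero    {m} {n} path = subst₂ (Star High) (sym (+-identityʳ m)) (sym (+-identityʳ n)) path
    High-shift (suc k) {m} {n} path = subst₂ (Star High) (+-assoc m N (k * N)) (+-assoc n N (k * N))
      (High-shift k (Star.gmap (_+ N)
        (λ ((N≤m , N≤n) , s) → (m≤n⇒m≤n+o N N≤m , m≤n⇒m≤n+o N N≤n) , to (periodic (both N≤m N≤n)) s) path))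

    -- The path v ⇝ w ⇝ v′, shifted by kN, continues a path that ends in v + kN.
    High-loop : ∀ {w v v′} k → Star High w v → Star High w (v + k * N) → Star High w v′ → Star High w (v′ + k * N)
    High-loop k w→v w→v+kN w→v′ = w→v+kN ◅◅ High-shift k (reverse High-sym w→v ◅◅ w→v′)

    UpClosed : ℕ → ℕ → Set
    UpClosed w K = ∀ {v} → K ≤ v → Star High w v → Star High w (v + K * N)

    UpClosed-stable : ∀ w → Stable (UpClosed w)
    UpClosed-stable w {M} K≢0 (divides-refl j) closed {v} K≤v path =
      subst (λ x → Star High w (v + x)) (sym (*-assoc j M N))
        (iterate-shift (Star High w) closed j (≤-trans (∣⇒≤ {{K≢0}} (n∣m*n j)) K≤v) path)

    -- If two distinct congruent numbers are reachable from `w`, `High-loop` translates every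
    -- reachable number by their difference. Otherwise each residue class holds at most one
    -- reachable number, so these are bounded and closure holds vacuously beyond the bound.
    upClosed : ∀ w → ∃⁺ (UpClosed w)
    upClosed w with em {∃₂ λ k v → NonZero k × Star High w v × Star High w (v + k * N)}
    ... | yes (k , v , k≢0 , w→v , w→v+kN) = k , k≢0 , λ _ → High-loop k w→v w→v+kN
    ... | no none =
        let B , B≢0 , bound = uniform Bound-stable bounds
        in B , B≢0 , λ {v} B≤v path →
             contradiction B≤v (<⇒≱ (bound (v mod N) path (sym (toℕ-fromℕ< (m%n<n v N)))))
      where
      Bound : Fin N → ℕ → Set
      Bound r B = ∀ {v} → Star High w v → v % N ≡ toℕ r → v < B
      Bound-stable : ∀ r → Stable (Bound r)
      Bound-stable r = monotone⇒stable {Bound r} λ m≤n bound path eq → <-≤-trans (bound path eq) m≤n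
      bounds : ∀ r → ∃⁺ (Bound r)
      bounds r with em {∃ λ v → Star High w v × v % N ≡ toℕ r}
      ... | no none = 1 , _ , λ path eq → contradiction (_ , path , eq) none
      ... | yes (v₀ , path₀ , eq₀) = suc v₀ , _ , λ {v} path eq → s≤s (≮⇒≥ λ v₀<v →
        let k , v≡ = congruent⇒shift N (<⇒≤ v₀<v) (trans eq₀ (sym eq))
        in none (k , v₀ , shift-nonZero k v₀<v v≡
                , path₀ , subst (Star High w) v≡ path))

    -- Only the part of a path before its first step below `N` can be translated, so the path is cut
    -- there.
    first-descent : ∀ {v u} → N ≤ v → Star S v u →
                    Star High v u ⊎ ∃₂ λ w j → Star High v w × j < N × S w j × Star S j u
    first-descent N≤v ε = inj₁ ε
    first-descent {v} N≤v (_◅_ {j = j} s path) with N ≤? j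
    ... | no N≰j = inj₂ (v , j , ε , ≰⇒> N≰j , s , path)
    ... | yes N≤j with first-descent N≤j path
    ...   | inj₁ high = inj₁ (((N≤v , N≤j) , s) ◅ high)
    ...   | inj₂ (w , i , high , rest) = inj₂ (w , i , ((N≤v , N≤j) , s) ◅ high , rest)

    -- A path from `v` to `u` stays high or first descends by an edge from `w` to some `j < N`. If
    -- `w` is at least `N` above `j`, this edge stretches to `w + K * N`, and the high part is
    -- translated. Otherwise `w < 2N`; hence `K` is chosen to work for the finitely many starting
    -- points below `suc u ⊔ (N + N)`.
    component-upClosed : ∀ u → ∃⁺ λ K → ∀ {v} → K + N ≤ v → Star S u v → Star S u (v + K * N)
    component-upClosed u =
        let K , K≢0 , closed = uniform {suc u ⊔ (N + N)} (λ w → UpClosed-stable (toℕ w)) (λ w → upClosed (toℕ w))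
        in K , K≢0 , λ K+N≤v path → extend (closed′ closed) (m+n≤o⇒m≤o K K+N≤v) path
             (first-descent (m+n≤o⇒n≤o K K+N≤v) (reverse S-sym path))
      where
      closed′ : ∀ {K M} → (∀ (w : Fin M) → UpClosed (toℕ w) K) → ∀ {w} → w < M → UpClosed w K
      closed′ {K} closed w<M = subst (λ w → UpClosed w K) (toℕ-fromℕ< w<M) (closed (fromℕ< w<M))
      extend : ∀ {K v} → (∀ {w} → w < suc u ⊔ (N + N) → UpClosed w K) → K ≤ v → Star S u v →
               Star High v u ⊎ (∃₂ λ w j → Star High v w × j < N × S w j × Star S j u) → Star S u (v + K * N)
      extend closed K≤v path (inj₁ high) = High⇒S (closed (m≤m⊔n (suc u) (N + N)) K≤v (reverse High-sym high))
      extend {K} {v} closed K≤v path (inj₂ (w , j , high , j<N , s , low)) with j + N ≤? w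
      ... | yes far = reverse S-sym low ◅◅ far-edge ◅ High⇒S (reverse High-sym (High-shift K high))
        where
        far-edge : S j (w + K * N)
        far-edge = iterate-shift (S j) (λ j+N≤v → to (periodic (right j+N≤v))) K far (S-sym s)
      ... | no near = reverse S-sym low ◅◅ S-sym s ◅
          High⇒S (closed (≤-trans (≤-trans (≰⇒> near) (+-monoˡ-≤ N (<⇒≤ j<N))) (m≤n⊔m (suc u) (N + N)))
                    K≤v (reverse High-sym high))

    component-periodic : ∀ u → ∃⁺ λ M → Periodic M (Star S u)
    component-periodic u with K , K≢0 , closed ← component-upClosed u =
      upward-closed⇒periodic (m*n≢0 K N {{K≢0}}) closed

  -- Finiteness by pigeonhole

  module _ (S : Setoid 0ℓ 0ℓ) where

    open Setoid S using (_≈_) renaming (Carrier to C; refl to ≈-refl; sym to ≈-sym; trans to ≈-trans)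

    -- A separated family is enlarged while some class is missed. It cannot reach `suc b` members,
    -- so it stops by meeting every class, and is then an enumeration; `k` counts the members still
    -- lacking.
    pigeonhole⇒finite : ∀ b → (∀ (g : Fin (suc b) → C) → ∃₂ λ i j → i ≢ j × g i ≈ g j) → FiniteSetoid S
    pigeonhole⇒finite b collide = extend (suc b) (λ ()) (λ { {()} }) (+-identityʳ (suc b))
      where
      Separated : ∀ {n} → (Fin n → C) → Set
      Separated g = ∀ {i j} → g i ≈ g j → i ≡ j
      extend : ∀ k {n} (g : Fin n → C) → Separated g → k + n ≡ suc b → FiniteSetoid S
      extend k {n} g separated eq with em {∃ λ c → ∀ i → ¬ g i ≈ c}
      extend zero    g separated refl | yes (c , new)
        with i , j , i≢j , gi≈gj ← collide g = contradiction (separated gi≈gj) i≢j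
      extend (suc k) {n} g separated eq | yes (c , new) = extend k g′ separated′ (trans (+-suc k n) eq)
        where
        g′ : Fin (suc n) → C
        g′ zero    = c
        g′ (suc i) = g i
        separated′ : Separated g′
        separated′ {zero}  {zero}  _  = refl
        separated′ {zero}  {suc j} eq = contradiction (≈-sym eq) (new j)
        separated′ {suc i} {zero}  eq = contradiction eq (new i)
        separated′ {suc i} {suc j} eq = cong suc (separated eq)
      extend k {n} g separated eq | no none = n , record
          { to        = index
          ; from      = g
          ; to-cong   = λ {c} {c′} c≈c′ → separated (≈-trans (hit c) (≈-trans c≈c′ (≈-sym (hit c′))))
          ; from-cong = λ { refl → ≈-refl }
          ; inverse   = (λ {i} {c} c≈gi → separated (≈-trans (hit c) c≈gi)) , λ { {c} refl → hit c }
          }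
        where
        cover : ∀ c → ∃ λ i → g i ≈ c
        cover c with em {∃ λ i → g i ≈ c}
        ... | yes found = found
        ... | no missing = contradiction (c , λ i gi≈c → missing (i , gi≈c)) none
        index : C → Fin n
        index c = proj₁ (cover c)
        hit : ∀ c → g (index c) ≈ c
        hit c = proj₂ (cover c)

  injection⇒finite : ∀ {Y : Set} {b} (g : Y → Fin b) → (∀ {x y} → g x ≡ g y → x ≡ y) → Finite Y
  injection⇒finite {Y} {b} g g-inj = pigeonhole⇒finite (setoid Y) b λ h →
    let i , j , i<j , eq = pigeonhole (n<1+n b) (g ∘ h) in i , j , (<⇒≢ i<j ∘ cong toℕ) , g-inj eq

module _ {S : Setoid 0ℓ 0ℓ} {n} (card : HasCardinality S n) where

  open Setoid S using (_≈_) renaming (refl to ≈-refl; sym to ≈-sym; trans to ≈-trans)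

  card-to-injective : ∀ {x y} → Inverse.to card x ≡ Inverse.to card y → x ≈ y
  card-to-injective eq = ≈-trans (≈-sym (Inverse.inverseʳ card refl)) (Inverse.inverseʳ card eq)

  card-from-injective : ∀ {i j} → Inverse.from card i ≈ Inverse.from card j → i ≡ j
  card-from-injective eq = trans (sym (Inverse.inverseˡ card ≈-refl)) (Inverse.inverseˡ card eq)

-- Components of a presented forest

module Components (em : ExcludedMiddle 0ℓ) {X : Set} (E : Rel X 0ℓ) where

  ~-sym : Symmetric (EqClosure E)
  ~-sym = EqClosure.symmetric E

  -- The stored path is irrelevant, but excluded middle decides connectedness and thus yields a
  -- usable path.
  connection : ∀ {x} (y : Component E x) → EqClosure E x (value y)
  connection (y , [ p ]) = recompute em p

  member : ∀ {x} y → EqClosure E x y → Component E x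
  member y p = y , [ p ]

  value-injective : ∀ {x} {y z : Component E x} → value y ≡ value z → y ≡ z
  value-injective refl = refl

  cardinality-≤ : ∀ {x y m n} → EqClosure E x y → HasCardinality (setoid (Component E x)) m →
                  HasCardinality (setoid (Component E y)) n → m ≤ n
  cardinality-≤ {x} {y} x~y cardx cardy = injective⇒≤
      {f = Inverse.to cardy ∘ move ∘ Inverse.from cardx}
      (λ eq → card-from-injective cardx (value-injective (cong value (card-to-injective cardy eq))))
    where
    move : Component E x → Component E y
    move z = member (value z) (~-sym x~y ◅◅ connection z)

  -- The path walked so far, appended to `p`, certifies that each intermediate vertex belongs to the
  -- component.
  lift-path : ∀ {x y z} (p : EqClosure E x y) (q : EqClosure E x z) → EqClosure E y z →
              EqClosure (ComponentEdge E x) (member y p) (member z q)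
  lift-path p q ε = ε
  lift-path p q (fwd e ◅ path) = fwd e ◅ lift-path (p ◅◅ return (fwd e)) q path
  lift-path p q (bwd e ◅ path) = bwd e ◅ lift-path (p ◅◅ return (bwd e)) q path

  component-tree : IsDirectedForest E → ∀ x → IsDirectedTree (ComponentEdge E x)
  component-tree forest x = record
    { directedForest = record
      { asymmetric = asymmetric
      ; forest = record
        { symmetric   = SymClosure.symmetric (ComponentEdge E x)
        ; irreflexive = λ { refl e → IsForest.irreflexive forest′ refl (SymClosure.gmap value id e) }
        ; acyclic     = λ c → IsForest.acyclic forest′ (record
            { n        = Cycle.n c
            ; vertex   = value ∘ Cycle.vertex c
            ; distinct = Cycle.distinct c ∘ value-injective
            ; edge     = SymClosure.gmap value id ∘ Cycle.edge c
            ; closing  = SymClosure.gmap value id (Cycle.closing c)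
            })
        }
      }
    ; connected = λ y z → lift-path (connection y) (connection z) (~-sym (connection y) ◅◅ connection z)
    }
    where open IsDirectedForest forest renaming (forest to forest′)

module Presented (em : ExcludedMiddle 0ℓ) {X : Set} {E : Rel X 0ℓ} (pres : Presentation U E) where

  open Presentation pres
  open Components em E

  f-injective : ∀ {x y} → f x ≡ f y → x ≡ y
  f-injective = injective _ _

  S : Rel ℕ 0ℓ
  S = Image U f (SymClosure E)

  S-sym : Symmetric S
  S-sym (x , y , _ , (eqx , eqy) , s) = y , x , _ , (eqy , eqx) , SymClosure.symmetric E s

  S-periodic : Periodic₂ N S
  S-periodic = Periodic₂-⇔ (mk⇔ join′ split) (Periodic₂-⊎ E-periodic (Periodic₂-flip E-periodic))
    where
    join′ : ∀ {m n} → Image U f E m n ⊎ Image U f E n m → S m n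
    join′ (inj₁ (x , y , _ , eqs , e)) = x , y , _ , eqs , fwd e
    join′ (inj₂ (y , x , _ , (eqy , eqx) , e)) = x , y , _ , (eqx , eqy) , bwd e
    split : ∀ {m n} → S m n → Image U f E m n ⊎ Image U f E n m
    split (x , y , _ , eqs , fwd e) = inj₁ (x , y , _ , eqs , e)
    split (x , y , _ , (eqx , eqy) , bwd e) = inj₂ (y , x , _ , (eqy , eqx) , e)

  S⁻¹ : ∀ {x y m n} → f x ≡ m → f y ≡ n → S m n → SymClosure E x y
  S⁻¹ eqx eqy (x′ , y′ , _ , (eqx′ , eqy′) , s) =
    subst₂ (SymClosure E) (f-injective (trans eqx′ (sym eqx))) (f-injective (trans eqy′ (sym eqy))) s

  path⁺ : ∀ {x y} → EqClosure E x y → Star S (f x) (f y)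
  path⁺ = Star.gmap f (λ s → _ , _ , _ , (refl , refl) , s)

  path⁻ : ∀ {x m n} → f x ≡ m → Star S m n → ∃ λ y → EqClosure E x y × f y ≡ n
  path⁻ {x} eq ε = x , ε , eq
  path⁻ eq ((x , y , _ , (eqx , eqy) , s) ◅ path)
    with refl ← f-injective (trans eq (sym eqx))
    with z , y~z , eqz ← path⁻ eqy path = z , s ◅ y~z , eqz

  open Connectivity em S-sym N≢0 S-periodic public

  -- The codes of a component form an ultimately periodic set by `component-periodic`, so the given
  -- presentation may be restricted to them.
  component-presentation : ∀ x → Presentation U (ComponentEdge E x)
  component-presentation x = restrict (common-multiple Periodic-stable
      (λ M≢0 N∣M (p , q) → Periodic₂-stable M≢0 N∣M p , Periodic₂-stable M≢0 N∣M q)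
      (component-periodic (f x)) (N , N≢0 , ≡-periodic , E-periodic))
    where
    Image⇔ : ∀ {R : Rel X 0ℓ} {R′ : Rel (Component E x) 0ℓ} → (∀ {y z} → R (value y) (value z) ⇔ R′ y z) →
             ∀ {m n} → (Image U f R m n × Star S (f x) m × Star S (f x) n) ⇔ Image U (f ∘ value) R′ m n
    Image⇔ {R} {R′} R⇔R′ = mk⇔
      (λ { ((y , z , _ , (refl , refl) , r) , p , q) →
             member y (trace p) , member z (trace q) , _ , (refl , refl) , to R⇔R′ r })
      (λ { (y , z , _ , (refl , refl) , r) →
             (value y , value z , _ , (refl , refl) , from R⇔R′ r) , path⁺ (connection y) , path⁺ (connection z) })
      where
      trace : ∀ {y} → Star S (f x) (f y) → EqClosure E x y
      trace p with _ , x~y , eq ← path⁻ refl p with refl ← f-injective eq = x~y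
    restrict : (∃⁺ λ M → Periodic M (Star S (f x)) ×
                  (Periodic₂ M (Image U f _≡_) × Periodic₂ M (Image U f E))) →
               Presentation U (ComponentEdge E x)
    restrict (M , M≢0 , K-per , ≡-per , E-per) = record
      { N = M ; N≢0 = M≢0 ; f = f ∘ value ; injective = λ _ _ → value-injective ∘ f-injective
      ; ≡-periodic = Periodic₂-⇔ (Image⇔ (mk⇔ value-injective (cong value))) (Periodic₂-restrict K-per ≡-per)
      ; E-periodic = Periodic₂-⇔ (Image⇔ (mk⇔ id id)) (Periodic₂-restrict K-per E-per)
      }

  -- A long edge (m , n) between high vertices would give the 4-cycle
  -- m — n + N — m + N — n + 2N.
  high-edge-short : IsDirectedForest E → ∀ {m n} → S m n → N ≤ m → n < m + N
  high-edge-short forest {m} {n} s N≤m with m + N ≤? n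
  ... | no near = ≰⇒> near
  ... | yes far = contradiction cycle (IsForest.acyclic (IsDirectedForest.forest forest))
    where
    far′ : m + N + N ≤ n + N
    far′ = +-monoˡ-≤ N far
    s₀₁ : S m (n + N)
    s₀₁ = to (S-periodic (right far)) s
    s₂₁ : S (m + N) (n + N)
    s₂₁ = to (S-periodic (both N≤m (≤-trans N≤m (m+n≤o⇒m≤o m far)))) s
    s₂₃ : S (m + N) (n + N + N)
    s₂₃ = to (S-periodic (right far′)) s₂₁
    s₀₃ : S m (n + N + N)
    s₀₃ = to (S-periodic (right (m≤n⇒m≤n+o N far))) s₀₁
    x₀ x₁ x₂ x₃ : X
    x₀ = proj₁ s₀₁
    x₁ = proj₁ (proj₂ s₀₁)
    x₂ = proj₁ s₂₃
    x₃ = proj₁ (proj₂ s₂₃)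
    f₀ : f x₀ ≡ m
    f₀ = proj₁ (proj₁ (proj₂ (proj₂ (proj₂ s₀₁))))
    f₁ : f x₁ ≡ n + N
    f₁ = proj₂ (proj₁ (proj₂ (proj₂ (proj₂ s₀₁))))
    f₂ : f x₂ ≡ m + N
    f₂ = proj₁ (proj₁ (proj₂ (proj₂ (proj₂ s₂₃))))
    f₃ : f x₃ ≡ n + N + N
    f₃ = proj₂ (proj₁ (proj₂ (proj₂ (proj₂ s₂₃))))
    grows : ∀ k → k < k + N
    grows k = m<m+n k (>-nonZero⁻¹ N {{N≢0}})
    m+N<n+N : m + N < n + N
    m+N<n+N = <-≤-trans (grows (m + N)) far′
    apart : ∀ {x y k l} → f x ≡ k → f y ≡ l → k < l → x ≢ y
    apart eqx eqy k<l refl = <⇒≢ k<l (trans (sym eqx) eqy)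
    x₀≢x₂ : x₀ ≢ x₂
    x₀≢x₂ = apart f₀ f₂ (grows m)
    x₂≢x₁ : x₂ ≢ x₁
    x₂≢x₁ = apart f₂ f₁ m+N<n+N
    x₁≢x₃ : x₁ ≢ x₃
    x₁≢x₃ = apart f₁ f₃ (grows (n + N))
    x₀≢x₁ : x₀ ≢ x₁
    x₀≢x₁ = apart f₀ f₁ (<-trans (grows m) m+N<n+N)
    x₂≢x₃ : x₂ ≢ x₃
    x₂≢x₃ = apart f₂ f₃ (<-trans m+N<n+N (grows (n + N)))
    x₀≢x₃ : x₀ ≢ x₃
    x₀≢x₃ = apart f₀ f₃ (<-trans (<-trans (grows m) m+N<n+N) (grows (n + N)))
    vertex : Fin 4 → X
    vertex zero                   = x₀
    vertex (suc zero)             = x₁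
    vertex (suc (suc zero))       = x₂
    vertex (suc (suc (suc zero))) = x₃
    distinct : ∀ {i j} → vertex i ≡ vertex j → i ≡ j
    distinct {zero} {zero} _ = refl
    distinct {zero} {suc zero} eq = contradiction eq x₀≢x₁
    distinct {zero} {suc (suc zero)} eq = contradiction eq x₀≢x₂
    distinct {zero} {suc (suc (suc zero))} eq = contradiction eq x₀≢x₃
    distinct {suc zero} {zero} eq = contradiction (sym eq) x₀≢x₁
    distinct {suc zero} {suc zero} _ = refl
    distinct {suc zero} {suc (suc zero)} eq = contradiction (sym eq) x₂≢x₁
    distinct {suc zero} {suc (suc (suc zero))} eq = contradiction eq x₁≢x₃
    distinct {suc (suc zero)} {zero} eq = contradiction (sym eq) x₀≢x₂
    distinct {suc (suc zero)} {suc zero} eq = contradiction eq x₂≢x₁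
    distinct {suc (suc zero)} {suc (suc zero)} _ = refl
    distinct {suc (suc zero)} {suc (suc (suc zero))} eq = contradiction eq x₂≢x₃
    distinct {suc (suc (suc zero))} {zero} eq = contradiction (sym eq) x₀≢x₃
    distinct {suc (suc (suc zero))} {suc zero} eq = contradiction (sym eq) x₁≢x₃
    distinct {suc (suc (suc zero))} {suc (suc zero)} eq = contradiction (sym eq) x₂≢x₃
    distinct {suc (suc (suc zero))} {suc (suc (suc zero))} _ = refl
    cycle : Cycle (SymClosure E)
    cycle = record
      { n        = 1
      ; vertex   = vertex
      ; distinct = distinct
      ; edge     = λ { zero → S⁻¹ f₀ f₁ s₀₁ ; (suc zero) → S⁻¹ f₁ f₂ (S-sym s₂₁) ; (suc (suc zero)) → S⁻¹ f₂ f₃ s₂₃ }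
      ; closing  = S⁻¹ f₃ f₀ (S-sym s₀₃)
      }

  -- Each step climbs by less than `N`, so a path that starts below the end of a window of length
  -- `N` cannot jump over it.
  crossing : IsDirectedForest E → ∀ {m v s} → (∀ {w} → Star S m w → N ≤ w) → m < s + N → s ≤ v →
             Star S m v → ∃ λ w → Star S m w × s ≤ w × w < s + N
  crossing forest {m} {v} {s} high m<s+N s≤v path with s ≤? m
  ... | yes s≤m = m , ε , s≤m , m<s+N
  crossing forest high m<s+N s≤v ε | no s≰m = contradiction s≤v s≰m
  crossing forest {s = s} high m<s+N s≤v (e ◅ path) | no s≰m
    with w , path′ , bounds ← crossing forest (λ p → high (e ◅ p))
           (<-trans (high-edge-short forest e (high ε)) (+-monoˡ-< N (≰⇒> s≰m))) s≤v path
    = w , e ◅ path′ , bounds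

  infinite⇒unbounded : ∀ {x} → Infinite (Component E x) → ∀ s → ∃ λ v → s ≤ v × Star S (f x) v
  infinite⇒unbounded {x} infinite s with em {∃ λ v → s ≤ v × Star S (f x) v}
  ... | yes found = found
  ... | no none = contradiction
      (injection⇒finite em (λ y → fromℕ< (below y))
        (λ {y} {z} eq → value-injective (f-injective (fromℕ<-injective _ _ (below y) (below z) eq))))
      infinite
    where
    below : ∀ (y : Component E x) → f (value y) < s
    below y = ≰⇒> λ s≤fy → none (_ , s≤fy , path⁺ (connection y))

  meets-window : IsDirectedForest E → ∀ {x} → Infinite (Component E x) → ∀ {s} → f x ≤ s →
                 ∃ λ w → Star S (f x) w × (w < N ⊎ (s ≤ w × w < s + N))
  meets-window forest {x} infinite {s} fx≤s with em {∃ λ w → Star S (f x) w × w < N}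
  ... | yes (w , path , w<N) = w , path , inj₁ w<N
  ... | no none with v , s≤v , path ← infinite⇒unbounded infinite s
                with w , path′ , bounds ← crossing forest (λ p → ≮⇒≥ λ w<N → none (_ , p , w<N))
                       (≤-<-trans fx≤s (m<m+n s (>-nonZero⁻¹ N {{N≢0}}))) s≤v path
    = w , path′ , inj₂ bounds

  finitely-many-infinite : IsDirectedForest E → FiniteSetoid (InfiniteComponents E)
  finitely-many-infinite forest = pigeonhole⇒finite em (InfiniteComponents E) (N + N) collide
    where
    collide : ∀ (g : Fin (suc (N + N)) → Setoid.Carrier (InfiniteComponents E)) →
              ∃₂ λ i j → i ≢ j × EqClosure E (proj₁ (g i)) (proj₁ (g j))
    -- The window is placed above the codes of all chosen representatives. Together with `[0, N)` it
    -- offers `N + N` places, so two of the components share a vertex.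
    collide g with s , below ← bounded (f ∘ proj₁ ∘ g) =
      let i , j , i<j , eq = pigeonhole (n<1+n (N + N)) colour
      in i , j , <⇒≢ i<j ∘ cong toℕ , meet i j (colour-injective i j eq)
      where
      window : ∀ i → ∃ λ w → Star S (f (proj₁ (g i))) w × (w < N ⊎ (s ≤ w × w < s + N))
      window i = meets-window forest (proj₂ (g i)) (<⇒≤ (below i))
      position : ∀ {w} → w < N ⊎ (s ≤ w × w < s + N) → Fin N ⊎ Fin N
      position (inj₁ w<N) = inj₁ (fromℕ< w<N)
      position {w} (inj₂ (s≤w , w<s+N)) = inj₂ (fromℕ< (m<n+o⇒m∸n<o w s {{N≢0}} w<s+N))
      position-injective : ∀ {v w} (p : v < N ⊎ (s ≤ v × v < s + N)) (q : w < N ⊎ (s ≤ w × w < s + N)) →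
                           position p ≡ position q → v ≡ w
      position-injective (inj₁ p) (inj₁ q) eq = fromℕ<-injective _ _ p q (inj₁-injective eq)
      position-injective {v} {w} (inj₂ (s≤v , p)) (inj₂ (s≤w , q)) eq =
        ∸-cancelʳ-≡ s≤v s≤w (fromℕ<-injective _ _ (m<n+o⇒m∸n<o v s {{N≢0}} p) (m<n+o⇒m∸n<o w s {{N≢0}} q) (inj₂-injective eq))
      colour : Fin (suc (N + N)) → Fin (N + N)
      colour i = join N N (position (proj₂ (proj₂ (window i))))
      colour-injective : ∀ i j → colour i ≡ colour j → proj₁ (window i) ≡ proj₁ (window j)
      colour-injective i j eq = position-injective (proj₂ (proj₂ (window i))) (proj₂ (proj₂ (window j)))
        (trans (sym (splitAt-join N N _)) (trans (cong (splitAt N) eq) (splitAt-join N N _)))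
      meet : ∀ i j → proj₁ (window i) ≡ proj₁ (window j) → EqClosure E (proj₁ (g i)) (proj₁ (g j))
      meet i j eq
        with y , x~y , fy≡ ← path⁻ refl (proj₁ (proj₂ (window i)))
        with z , x′~z , fz≡ ← path⁻ refl (proj₁ (proj₂ (window j)))
        with refl ← f-injective (trans fy≡ (trans eq (sym fz≡))) = x~y ◅◅ ~-sym x′~z

  -- Two congruent vertices would give infinitely many, by High-loop.
  high-cardinality : ∀ {x n} → (∀ {w} → Star S (f x) w → N ≤ w) →
                     HasCardinality (setoid (Component E x)) n → n ≤ N
  high-cardinality {x} {n} high card = ≮⇒≥ λ N<n → collide (pigeonhole N<n residue)
    where
    instance
      _ : NonZero N
      _ = N≢0
    vertex : Fin n → X
    vertex = value ∘ Inverse.from card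
    residue : Fin n → Fin N
    residue i = fromℕ< (m%n<n (f (vertex i)) N)
    vertex-path : ∀ i → Star High (f x) (f (vertex i))
    vertex-path i = raise high (path⁺ (connection (Inverse.from card i)))
      where
      raise : ∀ {m v} → (∀ {w} → Star S m w → N ≤ w) → Star S m v → Star High m v
      raise high ε = ε
      raise high (s ◅ path) = ((high ε , high (s ◅ ε)) , s) ◅ raise (λ p → high (s ◅ p)) path
    bound : ∃ λ b → ∀ {v} → Star S (f x) v → v < b
    bound with b , below ← bounded (f ∘ vertex) = b , λ path →
      let y , x~y , fy≡v = path⁻ refl path
          y′ = member y x~y
      in subst (_< b) (trans (cong (f ∘ value) (Inverse.inverseʳ card {y′} refl)) fy≡v) (below (Inverse.to card y′))
    incongruent : ∀ i j → residue i ≡ residue j → ¬ f (vertex i) < f (vertex j)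
    incongruent i j eq lt
      with k , w≡v+kN ← congruent⇒shift N (<⇒≤ lt) (fromℕ<-injective _ _ (m%n<n (f (vertex i)) N) (m%n<n (f (vertex j)) N) eq)
      with b , below ← bound
      -- Going round the loop `b` times raises the code by `b * (k * N)`, which is at least `b`,
      -- past the bound on all codes of the component.
      = <⇒≱ (below (High⇒S (iterate-shift (Star High (f x)) {0}
               (λ _ → High-loop k (vertex-path i) (subst (Star High (f x)) w≡v+kN (vertex-path j)))
               b z≤n (vertex-path i))))
          (m≤n⇒m≤o+n (f (vertex i)) (m≤m*n b (k * N) {{m*n≢0 k N {{shift-nonZero k lt w≡v+kN}}}}))
    collide : ¬ ∃₂ λ i j → toℕ i < toℕ j × residue i ≡ residue j
    collide (i , j , i<j , eq) with <-cmp (f (vertex i)) (f (vertex j))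
    ... | tri< lt _ _  = incongruent i j eq lt
    ... | tri≈ _ eq′ _ = <⇒≢ i<j (cong toℕ (card-from-injective card (value-injective (f-injective eq′))))
    ... | tri> _ _ gt  = incongruent j i (sym eq) gt

  -- Each code below `N` belongs to at most one component, and a finite component has only one
  -- cardinality. A code that meets no finite component imposes no constraint.
  low-cardinality : ∃ λ b → ∀ {x y n} → f x < N → EqClosure E x y →
                    HasCardinality (setoid (Component E y)) n → n ≤ b
  low-cardinality =
      let b , _ , bound = uniform Bound-stable bounds
      in b , λ fx<N → bound (fromℕ< fx<N) (sym (toℕ-fromℕ< fx<N))
    where
    Bound : Fin N → ℕ → Set
    Bound r b = ∀ {x y n} → f x ≡ toℕ r → EqClosure E x y → HasCardinality (setoid (Component E y)) n → n ≤ b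
    Bound-stable : ∀ r → Stable (Bound r)
    Bound-stable r = monotone⇒stable {Bound r} λ m≤n bound eq x~y card → ≤-trans (bound eq x~y card) m≤n
    bounds : ∀ r → ∃⁺ (Bound r)
    bounds r with em {∃₂ λ x y → f x ≡ toℕ r × EqClosure E x y × Finite (Component E y)}
    ... | no none = 1 , _ , λ eq x~y card → contradiction (_ , _ , eq , x~y , _ , card) none
    ... | yes (x , y , eq , x~y , m , card) = suc m , _ , λ eq′ x′~y′ card′ → m≤n⇒m≤1+n
      (cardinality-≤ (~-sym x′~y′ ◅◅ subst (λ x′ → EqClosure E x′ y) (f-injective (trans eq (sym eq′))) x~y) card′ card)

  finite-bounded : FiniteComponentsBounded E
  finite-bounded with b , low ← low-cardinality = N ⊔ b , bound
    where
    bound : ∀ x n → HasCardinality (setoid (Component E x)) n → n ≤ N ⊔ b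
    bound x n card with em {∃ λ w → Star S (f x) w × w < N}
    ... | no none = m≤n⇒m≤n⊔o b (high-cardinality (λ p → ≮⇒≥ λ w<N → none (_ , p , w<N)) card)
    ... | yes (w , path , w<N) with y , x~y , refl ← path⁻ refl path =
      m≤n⇒m≤o⊔n N (low w<N (~-sym x~y) card)

-- Disjoint unions

quotient-≤ : ∀ {w e k i} → e < w → k * w ≤ e + i * w → k ≤ i
quotient-≤ {w} {e} {k} {i} e<w k*w≤ = s≤s⁻¹ (*-cancelʳ-< w k (suc i) (≤-<-trans k*w≤ (+-monoˡ-< (i * w) e<w)))

quotient-unshift : ∀ {w e N m i} → e < w → m + N * w ≡ e + i * w → ∃ λ i₀ → i ≡ i₀ + N × m ≡ e + i₀ * w
quotient-unshift {w} {e} {N} {m} {i} e<w eq =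
    i ∸ N , sym (m∸n+n≡m N≤i) , +-cancelʳ-≡ (N * w) m (e + (i ∸ N) * w) (begin
      m + N * w                    ≡⟨ eq ⟩
      e + i * w                    ≡⟨ cong (λ i → e + i * w) (m∸n+n≡m N≤i) ⟨
      e + (i ∸ N + N) * w          ≡⟨ cong (e +_) (*-distribʳ-+ w (i ∸ N) N) ⟩
      e + ((i ∸ N) * w + N * w)    ≡⟨ +-assoc e _ _ ⟨
      e + (i ∸ N) * w + N * w      ∎)
  where
  open ≡-Reasoning
  N≤i : N ≤ i
  N≤i = quotient-≤ e<w (subst (N * w ≤_) eq (m≤n+m (N * w) m))

quotient-shift : ∀ w e N i → e + i * w + N * w ≡ e + (i + N) * w
quotient-shift w e N i = trans (+-assoc e (i * w) (N * w)) (cong (e +_) (sym (*-distribʳ-+ w i N)))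

-- Carries a relation over to one residue class modulo `w`; presentations are interleaved by giving
-- them different classes.
Dilate : ℕ → ℕ → Rel ℕ 0ℓ → Rel ℕ 0ℓ
Dilate w e R m n = ∃₂ λ i j → (m ≡ e + i * w × n ≡ e + j * w) × R i j

module _ {w e} (e<w : e < w) where

  private
    far : ∀ N i j → e + j * w + N * w ≤ e + i * w → j + N ≤ i
    far N i j le = *-cancelʳ-≤ (j + N) i w {{>-nonZero (≤-<-trans z≤n e<w)}}
      (+-cancelˡ-≤ e _ _ (subst (_≤ e + i * w) (quotient-shift w e N j) le))

  -- Within one residue class, shifts by `N * w` are shifts by `N` of the quotients;
  -- `Shift-undilate` reads this backwards.
  Shift-dilate : ∀ {N i j m′ n′} → Shift (N * w) (e + i * w) (e + j * w) m′ n′ →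
                 ∃₂ λ i′ j′ → (m′ ≡ e + i′ * w × n′ ≡ e + j′ * w) × Shift N i j i′ j′
  Shift-dilate {N} {i} {j} (both N≤m N≤n) = i + N , j + N , (quotient-shift w e N i , quotient-shift w e N j) ,
    both (quotient-≤ e<w N≤m) (quotient-≤ e<w N≤n)
  Shift-dilate {N} {i} {j} (left le)  = i + N , j , (quotient-shift w e N i , refl) , left (far N i j le)
  Shift-dilate {N} {i} {j} (right le) = i , j + N , (refl , quotient-shift w e N j) , right (far N j i le)

  Shift-undilate : ∀ {N m n m′ n′ i′ j′} → m′ ≡ e + i′ * w → n′ ≡ e + j′ * w → Shift (N * w) m n m′ n′ →
                   ∃₂ λ i j → (m ≡ e + i * w × n ≡ e + j * w) × Shift N i j i′ j′
  Shift-undilate {N} {i′ = i′} {j′} eqm eqn (both N≤m N≤n)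
    with i , refl , refl ← quotient-unshift {N = N} {i = i′} e<w eqm
    with j , refl , refl ← quotient-unshift {N = N} {i = j′} e<w eqn
    = i , j , (refl , refl) , both (quotient-≤ e<w N≤m) (quotient-≤ e<w N≤n)
  Shift-undilate {N} {i′ = i′} {j′} eqm refl (left le)
    with i , refl , refl ← quotient-unshift {N = N} {i = i′} e<w eqm = i , j′ , (refl , refl) , left (far N i j′ le)
  Shift-undilate {N} {i′ = i′} {j′} refl eqn (right le)
    with j , refl , refl ← quotient-unshift {N = N} {i = j′} e<w eqn = i′ , j , (refl , refl) , right (far N j i′ le)

  Periodic₂-dilate : ∀ {N R} → Periodic₂ N R → Periodic₂ (N * w) (Dilate w e R)
  Periodic₂-dilate {N} {R} periodic s = mk⇔
    (λ { (i , j , (refl , refl) , r) →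
           let i′ , j′ , eqs , s′ = Shift-dilate s in i′ , j′ , eqs , to (periodic s′) r })
    (λ { (i′ , j′ , (eqm , eqn) , r) →
           let i , j , eqs , s′ = Shift-undilate eqm eqn s in i , j , eqs , from (periodic s′) r })

Presentation-≐ : ∀ {X : Set} {P Q : Pred X 0ℓ} {E : Rel X 0ℓ} → P ≐ Q → Presentation P E → Presentation Q E
Presentation-≐ {X} {P} {Q} {E} (P⊆Q , Q⊆P) pres = record
  { N = N ; N≢0 = N≢0 ; f = f ; injective = λ q q′ → injective (Q⊆P q) (Q⊆P q′)
  ; ≡-periodic = Periodic₂-⇔ transport ≡-periodic ; E-periodic = Periodic₂-⇔ transport E-periodic }
  where
  open Presentation pres
  transport : ∀ {R : Rel X 0ℓ} {m n} → Image P f R m n ⇔ Image Q f R m n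
  transport = mk⇔ (λ (x , y , (p , q) , rest) → x , y , (P⊆Q p , P⊆Q q) , rest)
                  (λ (x , y , (p , q) , rest) → x , y , (Q⊆P p , Q⊆P q) , rest)

empty-presentation : ∀ {X : Set} {P : Pred X 0ℓ} {E : Rel X 0ℓ} → (∀ {x} → ¬ P x) → Presentation P E
empty-presentation none = record
  { N = 1 ; N≢0 = _ ; f = λ _ → 0 ; injective = λ p _ _ → contradiction p none
  ; ≡-periodic = λ _ → mk⇔ (λ (_ , _ , (p , _) , _) → contradiction p none) (λ (_ , _ , (p , _) , _) → contradiction p none)
  ; E-periodic = λ _ → mk⇔ (λ (_ , _ , (p , _) , _) → contradiction p none) (λ (_ , _ , (p , _) , _) → contradiction p none)
  }

module _ (em : ExcludedMiddle 0ℓ) {X : Set} {E : Rel X 0ℓ} where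

  Saturated : Pred X 0ℓ → Set
  Saturated P = ∀ {x y} → EqClosure E x y → P x → P y

  -- `P` receives even codes and `Q` odd ones. Both are unions of components, so no related pair
  -- joins them and each image relation is the union of two dilated ones.
  disjoint-union : ∀ {P Q : Pred X 0ℓ} → Saturated P → Saturated Q → (∀ {x} → P x → ¬ Q x) →
                   Presentation P E → Presentation Q E → Presentation (λ x → P x ⊎ Q x) E
  disjoint-union {P} {Q} satP satQ disjoint pres₁ pres₂ = record
      { N          = N₁ * N₂ * 2
      ; N≢0        = m*n≢0 (N₁ * N₂) 2 {{N≢0}}
      ; f          = h
      ; injective  = h-injective
      ; ≡-periodic = h-periodic (λ { refl → ε }) (rescale₁ I₁.≡-periodic) (rescale₂ I₂.≡-periodic)
      ; E-periodic = h-periodic (λ e → return (fwd e)) (rescale₁ I₁.E-periodic) (rescale₂ I₂.E-periodic)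
      }
    where
    module I₁ = Presentation pres₁
    module I₂ = Presentation pres₂
    open I₁ using () renaming (N to N₁; f to f₁)
    open I₂ using () renaming (N to N₂; f to f₂)
    N≢0 : NonZero (N₁ * N₂)
    N≢0 = m*n≢0 N₁ N₂ {{I₁.N≢0}} {{I₂.N≢0}}
    rescale₁ : ∀ {R} → Periodic₂ N₁ R → Periodic₂ (N₁ * N₂) R
    rescale₁ = Periodic₂-stable N≢0 (m∣m*n N₂)
    rescale₂ : ∀ {R} → Periodic₂ N₂ R → Periodic₂ (N₁ * N₂) R
    rescale₂ = Periodic₂-stable N≢0 (n∣m*n N₁)
    h : X → ℕ
    h x with em {P x}
    ... | yes _ = 0 + f₁ x * 2
    ... | no  _ = 1 + f₂ x * 2
    h-P : ∀ {x} → P x → h x ≡ 0 + f₁ x * 2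
    h-P {x} p with em {P x}
    ... | yes _ = refl
    ... | no ¬p = contradiction p ¬p
    h-Q : ∀ {x} → Q x → h x ≡ 1 + f₂ x * 2
    h-Q {x} q with em {P x}
    ... | yes p = contradiction q (disjoint p)
    ... | no  _ = refl
    evens≢odds : ∀ i j → 0 + i * 2 ≢ 1 + j * 2
    evens≢odds i j eq = even≢odd i j (trans (*-comm 2 i) (trans eq (cong suc (*-comm j 2))))
    h-injective : ∀ {x y} → P x ⊎ Q x → P y ⊎ Q y → h x ≡ h y → x ≡ y
    h-injective (inj₁ p) (inj₁ p′) eq = I₁.injective p p′
      (*-cancelʳ-≡ _ _ 2 (trans (sym (h-P p)) (trans eq (h-P p′))))
    h-injective (inj₂ q) (inj₂ q′) eq = I₂.injective q q′
      (*-cancelʳ-≡ _ _ 2 (suc-injective (trans (sym (h-Q q)) (trans eq (h-Q q′)))))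
    h-injective {x} {y} (inj₁ p) (inj₂ q) eq =
      contradiction (trans (sym (h-P p)) (trans eq (h-Q q))) (evens≢odds (f₁ x) (f₂ y))
    h-injective {x} {y} (inj₂ q) (inj₁ p) eq =
      contradiction (trans (sym (h-P p)) (trans (sym eq) (h-Q q))) (evens≢odds (f₁ y) (f₂ x))
    h-periodic : ∀ {R : Rel X 0ℓ} → (∀ {x y} → R x y → EqClosure E x y) →
                 Periodic₂ (N₁ * N₂) (Image P f₁ R) → Periodic₂ (N₁ * N₂) (Image Q f₂ R) →
                 Periodic₂ (N₁ * N₂ * 2) (Image (λ x → P x ⊎ Q x) h R)
    h-periodic {R} R⊆~ per₁ per₂ = Periodic₂-⇔ (mk⇔ join′ split)
        (Periodic₂-⊎ (Periodic₂-dilate {2} {0} (s≤s z≤n) per₁) (Periodic₂-dilate {2} {1} (s≤s (s≤s z≤n)) per₂))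
      where
      join′ : ∀ {m n} → Dilate 2 0 (Image P f₁ R) m n ⊎ Dilate 2 1 (Image Q f₂ R) m n →
              Image (λ x → P x ⊎ Q x) h R m n
      join′ (inj₁ (_ , _ , (refl , refl) , x , y , (p , p′) , (refl , refl) , r)) =
        x , y , (inj₁ p , inj₁ p′) , (h-P p , h-P p′) , r
      join′ (inj₂ (_ , _ , (refl , refl) , x , y , (q , q′) , (refl , refl) , r)) =
        x , y , (inj₂ q , inj₂ q′) , (h-Q q , h-Q q′) , r
      split : ∀ {m n} → Image (λ x → P x ⊎ Q x) h R m n →
              Dilate 2 0 (Image P f₁ R) m n ⊎ Dilate 2 1 (Image Q f₂ R) m n
      split (x , y , (inj₁ p , inj₁ p′) , (refl , refl) , r) =
        inj₁ (_ , _ , (h-P p , h-P p′) , x , y , (p , p′) , (refl , refl) , r)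
      split (x , y , (inj₂ q , inj₂ q′) , (refl , refl) , r) =
        inj₂ (_ , _ , (h-Q q , h-Q q′) , x , y , (q , q′) , (refl , refl) , r)
      split (x , y , (inj₁ p , inj₂ q) , _ , r) = contradiction q (disjoint (satP (R⊆~ r) p))
      split (x , y , (inj₂ q , inj₁ p) , _ , r) = contradiction (satQ (R⊆~ r) q) (disjoint p)

  open Components em E

  component⇒subset : ∀ {c} → Presentation U (ComponentEdge E c) → Presentation (EqClosure E c) E
  component⇒subset {c} pres = record
      { N = N ; N≢0 = N≢0 ; f = g
      ; injective = λ p q eq → cong value (injective _ _ (trans (sym (g-value (member _ p))) (trans eq (g-value (member _ q)))))
      ; ≡-periodic = Periodic₂-⇔ (Image⇔ (mk⇔ (cong value) value-injective)) ≡-periodic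
      ; E-periodic = Periodic₂-⇔ (Image⇔ (mk⇔ id id)) E-periodic
      }
    where
    open Presentation pres
    g : X → ℕ
    g y with em {EqClosure E c y}
    ... | yes p = f (member y p)
    -- An arbitrary default: images are taken over the component only.
    ... | no  _ = 0
    g-value : ∀ z → g (value z) ≡ f z
    g-value z with em {EqClosure E c (value z)}
    ... | yes _ = refl
    ... | no ¬p = contradiction (connection z) ¬p
    Image⇔ : ∀ {R′ : Rel (Component E c) 0ℓ} {R : Rel X 0ℓ} → (∀ {y z} → R′ y z ⇔ R (value y) (value z)) →
             ∀ {m n} → Image U f R′ m n ⇔ Image (EqClosure E c) g R m n
    Image⇔ R′⇔R = mk⇔
      (λ { (y , z , _ , (refl , refl) , r) →
             value y , value z , (connection y , connection z) , (g-value y , g-value z) , to R′⇔R r })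
      (λ { (y , z , (p , q) , (refl , refl) , r) →
             member y p , member z q , _ , (sym (g-value (member y p)) , sym (g-value (member z q))) , from R′⇔R r })

  finite-union : ∀ {r} (c : Fin r → X) → (∀ {i j} → EqClosure E (c i) (c j) → i ≡ j) →
                 (∀ i → Presentation (EqClosure E (c i)) E) →
                 Presentation (λ x → ∃ λ i → EqClosure E (c i) x) E
  finite-union {zero}  c separated pres = empty-presentation λ ()
  finite-union {suc r} c separated pres = Presentation-≐
    ((λ { (inj₁ p) → zero , p ; (inj₂ (i , p)) → suc i , p }) ,
     (λ { (zero , p) → inj₁ p ; (suc i , p) → inj₂ (i , p) }))
    (disjoint-union (λ x~y p → p ◅◅ x~y) (λ x~y (i , p) → i , p ◅◅ x~y)
      (λ p (i , q) → contradiction (separated (p ◅◅ ~-sym q)) λ ())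
      (pres zero) (finite-union (c ∘ suc) (λ eq → Fin.suc-injective (separated eq)) (pres ∘ suc)))

-- Finite components of bounded size

module Rank (em : ExcludedMiddle 0ℓ) (S : Pred ℕ 0ℓ) where

  -- The number of elements of `S` below the argument; on `S` it is the order isomorphism onto an
  -- initial segment of ℕ.
  rank : ℕ → ℕ
  rank zero = 0
  rank (suc n) with em {S n}
  ... | yes _ = suc (rank n)
  ... | no  _ = rank n

  rank-suc : ∀ {n} → S n → rank (suc n) ≡ suc (rank n)
  rank-suc {n} s with em {S n}
  ... | yes _ = refl
  ... | no ¬s = contradiction s ¬s

  rank-step : ∀ n → rank n ≤ rank (suc n)
  rank-step n with em {S n}
  ... | yes _ = n≤1+n (rank n)
  ... | no  _ = ≤-refl

  rank-mono : ∀ {m n} → m ≤′ n → rank m ≤ rank n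
  rank-mono ≤′-refl = ≤-refl
  rank-mono (≤′-step {n} m≤n) = ≤-trans (rank-mono m≤n) (rank-step n)

  rank-strict : ∀ {m n} → S m → m < n → rank m < rank n
  rank-strict s m<n = ≤-trans (≤-reflexive (sym (rank-suc s))) (rank-mono (≤⇒≤′ m<n))

  rank-injective : ∀ {m n} → S m → S n → rank m ≡ rank n → m ≡ n
  rank-injective {m} {n} s s′ eq with <-cmp m n
  ... | tri< lt _ _ = contradiction eq (<⇒≢ (rank-strict s lt))
  ... | tri≈ _ m≡n _ = m≡n
  ... | tri> _ _ gt = contradiction (sym eq) (<⇒≢ (rank-strict s′ gt))

  rank-onto : ∀ n {r} → r < rank n → ∃ λ m → S m × rank m ≡ r
  rank-onto (suc n) {r} r<rank with em {S n}
  ... | no _ = rank-onto n r<rank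
  ... | yes s with m≤n⇒m<n∨m≡n (s≤s⁻¹ r<rank)
  ...   | inj₁ lt = rank-onto n lt
  ...   | inj₂ eq = n , s , sym eq

  rank-onto-≤ : ∀ {n} → S n → ∀ {r} → r ≤ rank n → ∃ λ m → S m × rank m ≡ r
  rank-onto-≤ {n} s r≤rank = rank-onto (suc n) (subst (_ <_) (sym (rank-suc s)) (s≤s r≤rank))

open Rank using (rank)

-- Needed because vertices of one component give predicates `Codes` that agree only extensionally.
rank-ext : (em : ExcludedMiddle 0ℓ) {S S′ : Pred ℕ 0ℓ} → S ≐ S′ → ∀ n → rank em S n ≡ rank em S′ n
rank-ext em S≐S′ zero = refl
rank-ext em {S} {S′} S≐S′@(S⊆S′ , S′⊆S) (suc n) with em {S n} | em {S′ n}
... | yes _ | yes _ = cong suc (rank-ext em S≐S′ n)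
... | no  _ | no  _ = rank-ext em S≐S′ n
... | yes s | no ¬s = contradiction (S⊆S′ s) ¬s
... | no ¬s | yes s = contradiction (S′⊆S s) ¬s

-- The colour of `x` is the truth table of `P x` over the `n` encoded indices, which gives `2 ^ n`
-- colours.
classify : ExcludedMiddle 0ℓ → ∀ {X I : Set} {n} (encode : I → Fin n) (decode : Fin n → I) →
           (∀ i → decode (encode i) ≡ i) → (P : X → I → Set) →
           ∃₂ λ B (κ : X → Fin B) → ∀ {x y} → κ x ≡ κ y → ∀ i → P x i → P y i
classify em {X} {I} {n} encode decode decode-encode P = 2 ^ n , (λ x → funToFin (bit x)) , λ {x} {y} eq i p →
    subst (P y) (decode-encode i) (read y (encode i) (trans (sym (bit-cong eq (encode i)))
      (write x (encode i) (subst (P x) (sym (decode-encode i)) p))))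
  where
  bit : X → Fin n → Fin 2
  bit x i with em {P x (decode i)}
  ... | yes _ = suc zero
  ... | no  _ = zero
  write : ∀ x i → P x (decode i) → bit x i ≡ suc zero
  write x i p with em {P x (decode i)}
  ... | yes _ = refl
  ... | no ¬p = contradiction p ¬p
  read : ∀ y i → bit y i ≡ suc zero → P y (decode i)
  read y i eq with em {P y (decode i)}
  ... | yes p = p
  read y i () | no _
  bit-cong : ∀ {x y} → funToFin (bit x) ≡ funToFin (bit y) → ∀ i → bit x i ≡ bit y i
  bit-cong {x} {y} eq i = trans (sym (finToFun-funToFin (bit x) i))
    (trans (cong (λ k → finToFun k i) eq) (finToFun-funToFin (bit y) i))

-- Number the components of each isomorphism type; the blocks of vertices of the
-- q-th components of all types together form the q-th period.  The injection
-- into ℕ orders both the vertices of a component and the components themselves.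
module FiniteComponents (em : ExcludedMiddle 0ℓ) {X : Set} (E : Rel X 0ℓ) (countable : Countable X)
                        {b : ℕ} (bound : ∀ x n → HasCardinality (setoid (Component E x)) n → n ≤ b) where

  open Components em E

  private
    infix 4 _~_
    _~_ : Rel X 0ℓ
    _~_ = EqClosure E

  c : X → ℕ
  c = Injection.to countable

  c-injective : ∀ {x y} → c x ≡ c y → x ≡ y
  c-injective = Injection.injective countable

  F : Pred X 0ℓ
  F x = Finite (Component E x)

  F-saturated : Saturated em {E = E} F
  F-saturated {x} {y} x~y (n , card) = injection⇒finite em
    (λ z → Inverse.to card (member (value z) (x~y ◅◅ connection z)))
    (λ eq → value-injective (cong value (card-to-injective card eq)))

  Codes : X → Pred ℕ 0ℓ
  Codes x m = ∃ λ y → x ~ y × c y ≡ m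

  Codes-≐ : ∀ {x y} → x ~ y → Codes x ≐ Codes y
  Codes-≐ x~y = (λ (z , x~z , eq) → z , ~-sym x~y ◅◅ x~z , eq) , (λ (z , y~z , eq) → z , x~y ◅◅ y~z , eq)

  position : X → ℕ
  position x = rank em (Codes x) (c x)

  position-≡ : ∀ {x y} → x ~ y → rank em (Codes x) (c y) ≡ position y
  position-≡ {x} {y} x~y = rank-ext em (Codes-≐ x~y) (c y)

  position-injective : ∀ {x y} → x ~ y → position x ≡ position y → x ≡ y
  position-injective {x} {y} x~y eq = c-injective (Rank.rank-injective em (Codes x)
    (x , ε , refl) (y , x~y , refl) (trans eq (sym (position-≡ x~y))))

  position-onto : ∀ x {r} → r ≤ position x → ∃ λ y → x ~ y × position y ≡ r
  position-onto x r≤ with _ , (y , x~y , refl) , eq ← Rank.rank-onto-≤ em (Codes x) (x , ε , refl) r≤ =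
    y , x~y , trans (sym (position-≡ x~y)) eq

  -- Every position up to that of `x` is taken by some vertex of the component, and these vertices
  -- are distinct.
  position-≤ : ∀ {x} → F x → position x ≤ b
  position-≤ {x} (n , card) = ≤-trans (<⇒≤ (injective⇒≤ {f = Inverse.to card ∘ vertex} vertex-injective)) (bound x n card)
    where
    at : (i : Fin (suc (position x))) → ∃ λ y → x ~ y × position y ≡ toℕ i
    at i = position-onto x (s≤s⁻¹ (toℕ<n i))
    vertex : Fin (suc (position x)) → Component E x
    vertex i = member (proj₁ (at i)) (proj₁ (proj₂ (at i)))
    vertex-injective : ∀ {i j} → Inverse.to card (vertex i) ≡ Inverse.to card (vertex j) → i ≡ j
    vertex-injective {i} {j} eq = toℕ-injective (trans (sym (proj₂ (proj₂ (at i))))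
      (trans (cong (position ∘ value) (card-to-injective card eq)) (proj₂ (proj₂ (at j)))))

  -- Reduction modulo `suc b` makes this total; on finite components it loses nothing, as positions
  -- are at most `b`.
  slot : X → Fin (suc b)
  slot x = position x mod suc b

  slot-injective : ∀ {x y} → F x → x ~ y → slot x ≡ slot y → x ≡ y
  slot-injective {x} {y} fin x~y eq = position-injective x~y (begin
    position x           ≡⟨ m<n⇒m%n≡m (s≤s (position-≤ fin)) ⟨
    position x % suc b   ≡⟨ fromℕ<-injective _ _ (m%n<n (position x) (suc b)) (m%n<n (position y) (suc b)) eq ⟩
    position y % suc b   ≡⟨ m<n⇒m%n≡m (s≤s (position-≤ (F-saturated x~y fin))) ⟩
    position y           ∎)
    where open ≡-Reasoning

  -- The vertex of position 0, a canonical representative of the component.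
  leader : X → X
  leader x = proj₁ (position-onto x z≤n)

  ~leader : ∀ x → x ~ leader x
  ~leader x = proj₁ (proj₂ (position-onto x z≤n))

  leader-position : ∀ x → position (leader x) ≡ 0
  leader-position x = proj₂ (proj₂ (position-onto x z≤n))

  leader-unique : ∀ {x z} → z ~ x → position z ≡ 0 → leader x ≡ z
  leader-unique {x} z~x z≡0 = position-injective (~-sym (z~x ◅◅ ~leader x)) (trans (leader-position x) (sym z≡0))

  leader-cong : ∀ {x y} → x ~ y → leader x ≡ leader y
  leader-cong {x} {y} x~y = leader-unique (~-sym (x~y ◅◅ ~leader y)) (leader-position y)

  relation : Fin 2 → Rel X 0ℓ
  relation zero       = _≡_
  relation (suc zero) = E

  relation⊆~ : ∀ r {x y} → relation r x y → x ~ y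
  relation⊆~ zero       refl = ε
  relation⊆~ (suc zero) e    = return (fwd e)

  -- These properties describe a finite component up to isomorphism: with equality they tell which
  -- slots are occupied, with `E` which slots are joined by an edge.
  Pattern : X → Fin 2 × Fin (suc b) × Fin (suc b) → Set
  Pattern z (r , i , j) = ∃₂ λ x y → (z ~ x × z ~ y) × (slot x ≡ i × slot y ≡ j) × relation r x y

  abstract
    classification : ∃₂ λ B (κ : X → Fin B) → ∀ {x y} → κ x ≡ κ y → ∀ p → Pattern x p → Pattern y p
    classification = classify em (λ (r , i , j) → combine r (combine i j))
      (map₂ (remQuot (suc b)) ∘ remQuot (suc b * suc b))
      (λ (r , i , j) → trans (cong (map₂ (remQuot (suc b))) (remQuot-combine r (combine i j)))
                             (cong (r ,_) (remQuot-combine i j)))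
      Pattern

  B : ℕ
  B = proj₁ classification

  κ : X → Fin B
  κ = proj₁ (proj₂ classification)

  κ-resp : ∀ {x y} → κ x ≡ κ y → ∀ p → Pattern x p → Pattern y p
  κ-resp = proj₂ (proj₂ classification)

  type : X → Fin B
  type x = κ (leader x)

  LeaderOf : Fin B → Pred X 0ℓ
  LeaderOf t z = F z × position z ≡ 0 × κ z ≡ t

  Leaders : Fin B → Pred ℕ 0ℓ
  Leaders t m = ∃ λ z → LeaderOf t z × c z ≡ m

  index : X → ℕ
  index x = rank em (Leaders (type x)) (c (leader x))

  leads : ∀ {x} → F x → LeaderOf (type x) (leader x)
  leads {x} fin = F-saturated (~leader x) fin , leader-position x , refl

  Hit : Fin B → ℕ → Set
  Hit t q = ∃ λ z → LeaderOf t z × rank em (Leaders t) (c z) ≡ q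

  hit-below : ∀ {x q} → F x → q ≤ index x → Hit (type x) q
  hit-below {x} fin q≤ with _ , (z , lead , refl) , eq ←
    Rank.rank-onto-≤ em (Leaders (type x)) (leader x , leads fin , refl) q≤ = z , lead , eq

  -- The block length: one place for each type and slot, and one more so that `W` is visibly
  -- nonzero.
  W : ℕ
  W = suc (B * suc b)

  offset : X → ℕ
  offset x = toℕ (combine (type x) (slot x))

  offset<W : ∀ x → offset x < W
  offset<W x = m≤n⇒m≤1+n (toℕ<n (combine (type x) (slot x)))

  h : X → ℕ
  h x = offset x + index x * W

  h-injective : ∀ {x y} → F x → F y → h x ≡ h y → x ≡ y
  h-injective {x} {y} fin fin′ eq = slot-injective fin x~y (proj₂ type-slot)
    where
    index≡ : index x ≡ index y
    index≡ = ≤-antisym (quotient-≤ (offset<W y) (≤-trans (m≤n+m (index x * W) (offset x)) (≤-reflexive eq)))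
                       (quotient-≤ (offset<W x) (≤-trans (m≤n+m (index y * W) (offset y)) (≤-reflexive (sym eq))))
    offset≡ : offset x ≡ offset y
    offset≡ = +-cancelʳ-≡ (index x * W) (offset x) (offset y) (trans eq (cong (λ q → offset y + q * W) (sym index≡)))
    type-slot : type x ≡ type y × slot x ≡ slot y
    type-slot = combine-injective (type x) (slot x) (type y) (slot y) (toℕ-injective offset≡)
    leader≡ : leader x ≡ leader y
    leader≡ = c-injective (Rank.rank-injective em (Leaders (type x)) (_ , leads fin , refl)
      (_ , subst (λ t → LeaderOf t (leader y)) (sym (proj₁ type-slot)) (leads fin′) , refl)
      (trans index≡ (cong (λ t → rank em (Leaders t) (c (leader y))) (sym (proj₁ type-slot)))))
    x~y : x ~ y
    x~y = subst (x ~_) leader≡ (~leader x) ◅◅ ~-sym (~leader y)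

  Settled : Fin B → ℕ → Set
  Settled t K = (∀ {x} → F x → type x ≡ t → index x < K) ⊎ (∀ q → Hit t q)

  -- The indices used by a type form an initial segment of ℕ, so a single missing index bounds them
  -- all.
  settled : ∀ t → ∃⁺ (Settled t)
  settled t with em {∃ λ q → ¬ Hit t q}
  ... | yes (q , miss) = suc q , _ , inj₁ λ { fin refl → s≤s (≮⇒≥ λ q<index → miss (hit-below fin (<⇒≤ q<index))) }
  ... | no none = 1 , _ , inj₂ hit
    where
    hit : ∀ q → Hit t q
    hit q with em {Hit t q}
    ... | yes found = found
    ... | no miss = contradiction (q , miss) none

  settled-stable : ∀ t → Stable (Settled t)
  settled-stable t = monotone⇒stable {Settled t} λ where
    K≤L (inj₁ few)  → inj₁ λ fin eq → <-≤-trans (few fin eq) K≤L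
    K≤L (inj₂ many) → inj₂ many

  module _ {K} (K≢0 : NonZero K) (settle : ∀ t → Settled t K) where

    -- An index of at least `K` means that every index occurs for the type of `x`. The component
    -- with index `q` has the same pattern, so it contains a related pair in the same slots.
    move : ∀ r {x y} → F x → relation r x y → K ≤ index x → ∀ q →
           Image F h (relation r) (offset x + q * W) (offset y + q * W)
    move r {x} {y} fin rel K≤index q with settle (type x)
    ... | inj₁ few  = contradiction K≤index (<⇒≱ (few fin refl))
    ... | inj₂ many
      with z , (finz , z≡0 , κz) , rank≡q ← many q
      with x′ , y′ , (z~x′ , z~y′) , (slotx , sloty) , rel′ ← κ-resp (sym κz) (r , slot x , slot y)
             (x , y , (~-sym (~leader x) , ~-sym (~leader x) ◅◅ relation⊆~ r rel) , (refl , refl) , rel)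
      = x′ , y′ , (F-saturated z~x′ finz , F-saturated z~y′ finz) ,
        (code x′ x z~x′ refl slotx , code y′ y z~y′ (cong κ (leader-cong (relation⊆~ r rel))) sloty) , rel′
      where
      code : ∀ u v → z ~ u → type x ≡ type v → slot u ≡ slot v → h u ≡ offset v + q * W
      code u v z~u type≡ slot≡ = cong₂ (λ o i → o + i * W)
          (cong toℕ (cong₂ combine (trans type-u type≡) slot≡))
          (trans (cong₂ (λ t l → rank em (Leaders t) (c l)) type-u (leader-unique z~u z≡0)) rank≡q)
        where
        type-u : type u ≡ type x
        type-u = trans (cong κ (leader-unique z~u z≡0)) κz

    index-cong : ∀ {x y} → x ~ y → index x ≡ index y
    index-cong x~y = cong (λ l → rank em (Leaders (κ l)) (c l)) (leader-cong x~y)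

    -- Vertices of one component lie in the same block, so their codes differ by less than `W`.
    not-far : ∀ {x y} → x ~ y → ¬ h x + K * W ≤ h y
    not-far {x} {y} x~y = <⇒≱ (begin-strict
      offset y + index y * W           ≡⟨ cong (λ q → offset y + q * W) (index-cong x~y) ⟨
      offset y + index x * W           <⟨ +-monoˡ-< (index x * W) (offset<W y) ⟩
      W + index x * W                  ≤⟨ +-monoˡ-≤ (index x * W) (m≤n*m W K {{K≢0}}) ⟩
      K * W + index x * W              ≡⟨ +-comm (K * W) (index x * W) ⟩
      index x * W + K * W              ≤⟨ +-monoˡ-≤ (K * W) (m≤n+m (index x * W) (offset x)) ⟩
      offset x + index x * W + K * W   ∎)
      where open ≤-Reasoning

    h-periodic : ∀ r → Periodic₂ (K * W) (Image F h (relation r))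
    h-periodic r (both N≤m N≤n) = mk⇔
      (λ { (x , y , (fin , _) , (refl , refl) , rel) → subst₂ (Image F h (relation r))
             (sym (quotient-shift W (offset x) K (index x)))
             (trans (sym (quotient-shift W (offset y) K (index x)))
                    (cong (λ q → offset y + q * W + K * W) (index-cong (relation⊆~ r rel))))
             (move r fin rel (quotient-≤ (offset<W x) N≤m) (index x + K)) })
      (λ { (x , y , (fin , _) , (eqx , eqy) , rel) → down x y fin eqx eqy rel })
      where
      down : ∀ {m n} x y → F x → h x ≡ m + K * W → h y ≡ n + K * W → relation r x y → Image F h (relation r) m n
      down x y fin eqx eqy rel
        with q , index≡ , refl ← quotient-unshift {N = K} {i = index x} (offset<W x) (sym eqx)
        with q′ , index≡′ , refl ← quotient-unshift {N = K} {i = index y} (offset<W y) (sym eqy)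
        with refl ← +-cancelʳ-≡ K q q′ (trans (sym index≡) (trans (index-cong (relation⊆~ r rel)) index≡′))
        = move r fin rel (subst (K ≤_) (sym index≡) (m≤n+m K q)) q
    -- Related vertices lie in one component, and so never have codes `K * W` apart: both sides are
    -- empty.
    h-periodic r (left far) = mk⇔
      (λ { (x , y , _ , (refl , refl) , rel) → contradiction far (not-far (~-sym (relation⊆~ r rel))) })
      (λ { (x , y , _ , (eqx , refl) , rel) →
             contradiction (≤-trans far (≤-trans (m≤m+n _ (K * W)) (≤-reflexive (sym eqx))))
                           (not-far (~-sym (relation⊆~ r rel))) })
    h-periodic r (right far) = mk⇔
      (λ { (x , y , _ , (refl , refl) , rel) → contradiction far (not-far (relation⊆~ r rel)) })
      (λ { (x , y , _ , (refl , eqy) , rel) →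
             contradiction (≤-trans far (≤-trans (m≤m+n _ (K * W)) (≤-reflexive (sym eqy)))) (not-far (relation⊆~ r rel)) })

  presentation : Presentation F E
  presentation = present (uniform settled-stable settled)
    where
    present : (∃⁺ λ K → ∀ t → Settled t K) → Presentation F E
    present (K , K≢0 , settle) = record
      { N = K * W ; N≢0 = m*n≢0 K W {{K≢0}} ; f = h ; injective = h-injective
      ; ≡-periodic = h-periodic K≢0 settle zero ; E-periodic = h-periodic K≢0 settle (suc zero) }

-- The two directions of the equivalence

module _ (em : ExcludedMiddle 0ℓ) (X : Set) (E : Rel X 0ℓ) (countable : Countable X) (forest : IsDirectedForest E) where

  Conditions : Set
  Conditions = (FiniteSetoid (InfiniteComponents E)
    × (∀ x → Infinite (Component E x) →
         IsDirectedTree (ComponentEdge E x) × UnaryFAPresentable (ComponentEdge E x)))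
    × FiniteComponentsBounded E

  necessary : UnaryFAPresentable E → Conditions
  necessary pres = (finitely-many-infinite forest , λ x _ →
      Components.component-tree em E forest x , presentation⇒UnaryFAPresentable em (component-presentation x)) ,
    finite-bounded
    where open Presented em (LeastRepresentatives.presentation em pres)

  -- The vertices of finite components are presented together, and those of the infinite ones as a
  -- finite union over one representative each. The two sets are saturated, disjoint and cover `X`.
  sufficient : Conditions → UnaryFAPresentable E
  sufficient (((r , card) , presented) , b , bound) = presentation⇒UnaryFAPresentable em
      (Presentation-≐ ((λ _ → _) , λ {x} _ → cover x)
        (disjoint-union em F-saturated (λ x~y (i , p) → i , p ◅◅ x~y)
          (λ finite (i , c~x) → proj₂ (Inverse.from card i) (F-saturated (~-sym c~x) finite))
          presentation
          (finite-union em c (card-from-injective card) λ i → component⇒subset em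
            (LeastRepresentatives.presentation em (proj₂ (presented (c i) (proj₂ (Inverse.from card i))))))))
    where
    open Components em E using (~-sym)
    open FiniteComponents em E countable bound using (F; F-saturated; presentation)
    c : Fin r → X
    c i = proj₁ (Inverse.from card i)
    cover : ∀ x → F x ⊎ ∃ λ i → EqClosure E (c i) x
    cover x with em {F x}
    ... | yes finite = inj₁ finite
    ... | no infinite = inj₂ (Inverse.to card (x , infinite) , Inverse.inverseʳ card refl)

theorem6p12 : ExcludedMiddle 0ℓ →
    (X : Set) (E : Rel X 0ℓ) → Countable X → IsDirectedForest E →
    UnaryFAPresentable E ⇔
    ((FiniteSetoid (InfiniteComponents E)
    × (∀ x → Infinite (Component E x) →
    IsDirectedTree (ComponentEdge E x) × UnaryFAPresentable (ComponentEdge E x)))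
    × FiniteComponentsBounded E)
theorem6p12 em X E countable forest =
  mk⇔ (necessary em X E countable forest) (sufficient em X E countable forest)
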